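{- Let $l\ge2$ be an integer and let $L_{rel}$ be a first-order language with relational vocabulary $\{R_1,\ldots,R_\rho\}$, $\rho>0$, where each $R_k$ has arity $r_k\ge2$. (i) For every $I\subseteq\{1,\ldots,\rho\}$ there are constants $\mu,\lambda>0$ such that, for all sufficiently large $n$, the proportion of $\mathcal{M}\in\mathbf{C}^I_n$ which have an $l$-colouring that is not $\mu n$-rich is at most $2^{ -\lambda n^m}$, where $m$ is the maximum arity of the relation symbols. Consequently, the proportion of $\mathcal{M}\in\mathbf{C}^I_n$ which have only $\mu n$-rich $l$-colourings approaches $1$ as $n\to\infty$. (ii) If at least one relation symbol has arity $\le l$, then for every $I\subseteq\{1,\ldots,\rho\}$ there are constants $\mu,\lambda>0$ such that, for all sufficiently large $n$, the proportion of $\mathcal{M}\in\mathbf{S}^I_n$ which have a strong $l$-colouring that is not $\mu n$-rich is at most $2^{ -\lambda n^m}$, where $m$ is the largest arity $\le l$ of a relation symbol. Consequently, the proportion of $\mathcal{M}\in\mathbf{S}^I_n$ which have only $\mu n$-rich strong $l$-colourings approaches $1$ as $n\to\infty$.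
   Context: An $l$-colouring of an $L_{rel}$-structure $\mathcal{M}$ is a function $\gamma:M\to\{1,\ldots,l\}$ such that for every $k$ and every $(a_1,\ldots,a_{r_k})\in R_k^{\mathcal{M}}$ there are $i,j$ with $\gamma(a_i)\ne\gamma(a_j)$; it is a strong $l$-colouring if for every $k$ and every $(a_1,\ldots,a_{r_k})\in R_k^{\mathcal{M}}$, $\gamma(a_i)\neq\gamma(a_j)$ whenever $i\neq j$. $\mathcal{M}$ is (strongly) $l$-colourable if it has a (strong) $l$-colouring. For $I\subseteq\{1,\ldots,\rho\}$, $\mathbf{C}^I_n$ (respectively $\mathbf{S}^I_n$) is the set of $l$-colourable (respectively strongly $l$-colourable) $L_{rel}$-structures $\mathcal{M}$ with universe $\{1,\ldots,n\}$ such that for every $k\in I$, $R_k^{\mathcal{M}}$ is irreflexive (all entries of each tuple in it are distinct) and symmetric (closed under permuting the entries of tuples). For $\alpha\in\mathbb{R}$, a function $\gamma:\{1,\ldots,n\}\to\{1,\ldots,l\}$ is $\alpha$-rich if $|\gamma^{ -1}(i)|\ge\alpha$ for every $i\in\{1,\ldots,l\}$. -}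

module Defs where

open import Algebra.Definitions.RawSemiring using () renaming (_^_ to pow)
open import Data.Fin using (Fin; finToFun; funToFin; combine)
open import Data.Fin.Permutation
  using (Permutation′; permutation; _⟨$⟩ʳ_; _⟨$⟩ˡ_; inverseˡ; inverseʳ)
open import Data.Fin.Properties
  using (all?; any?; _≟_; finToFun-funToFin)
open import Data.Fin.Subset using (Subset; inside; outside; _∈_) renaming (⊥ to ∅)
open import Data.Fin.Subset.Properties using (_∈?_; ∉⊥)
open import Data.Integer using (+_) renaming (∣_∣ to ∣_∣ℤ)
open import Data.List using (List; []; _∷_; cartesianProductWith; filter; length; map)
open import Data.List.Extrema.Nat using (max)
import Data.List.Membership.Propositional as List
open import Data.List.Membership.Propositional.Properties
  using (∈-cartesianProductWith⁺; ∈-map⁺; ∈-filter⁺; ∈-length)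
open import Data.List.Relation.Unary.All as ListAll using ()
open import Data.List.Relation.Unary.AllPairs as AllPairs using ()
open import Data.List.Relation.Unary.Any using (here; there)
open import Data.List.Relation.Unary.Unique.Propositional using (Unique)
open import Data.List.Relation.Unary.Unique.Propositional.Properties
  using (cartesianProductWith⁺; map⁺)
open import Data.Nat using (ℕ; zero; suc; _^_; NonZero; NonTrivial; >-nonZero)
  renaming (_*_ to _*ℕ_; _≤_ to _≤ℕ_; _<_ to _<ℕ_)
open import Data.Nat.Properties using () renaming (_≤?_ to _≤?ℕ_)
open import Data.Product using (∃; ∃-syntax; _×_; _,_)
open import Data.Rational using (ℚ; 1ℚ; _/_; _*_; _-_; _≤_; _<_; ∣_∣; ↥_; ↧ₙ_; 0ℚ)
open import Data.Rational.Base using (+-*-rawSemiring)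
open import Data.Rational.Properties using () renaming (_≤?_ to _≤?ℚ_)
open import Data.Vec using (Vec; []; _∷_; lookup; toList; count; allFin)
open import Data.Vec.Relation.Unary.All as VecAll using (All; []; _∷_)
open import Data.Vec.Relation.Unary.All.Properties using (lookup⁺)
open import Function using (_∘_)
open import Relation.Binary.PropositionalEquality
  using (_≡_; _≢_; _≗_; refl; sym; trans; cong; cong₂; subst)
open import Relation.Nullary using (Dec; ¬_; ¬?; contradiction)
open import Relation.Nullary.Decidable using (map′; _×-dec_; _→-dec_)
open import Relation.Unary using (Pred; Decidable)
open import Relation.Unary.Properties using (_∩?_)
open import Level using (0ℓ)

record Vocabulary : Set where
  field
    ρ       : ℕ
    ρ>0     : 0 <ℕ ρ
    arities : Vec ℕ ρ

  arity : Fin ρ → ℕ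
  arity = lookup arities

  field
    arity≥2 : ∀ k → 2 ≤ℕ arity k

  -- The bound 0 only serves as the maximum of an empty list.
  maxArity : ℕ
  maxArity = max 0 (toList arities)

  maxArity≤ : ℕ → ℕ
  maxArity≤ l = max 0 (filter (_≤?ℕ l) (toList arities))

open Vocabulary public

Tuple : ℕ → ℕ → Set
Tuple r n = Fin r → Fin n

-- An r-ary relation on Fin n, a set of r-tuples, is kept as a subset of
-- Fin (n ^ r) along the bijection funToFin, so that _≡_ on relations (and on
-- structures) is extensional equality and structures can be counted.
record Relation (n r : ℕ) : Set where
  constructor relation
  field
    graph : Subset (n ^ r)

open Relation public

infix 4 _∈ᴿ_
_∈ᴿ_ : ∀ {n r} → Tuple r n → Relation n r → Set
a ∈ᴿ R = funToFin a ∈ graph R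

StructureOver : ∀ {ρ} → ℕ → Vec ℕ ρ → Set
StructureOver n = All (Relation n)

record Structure (L : Vocabulary) (n : ℕ) : Set where
  constructor structure
  field
    relations : StructureOver n (arities L)

  ⟦_⟧ : (k : Fin (ρ L)) → Relation n (arity L k)
  ⟦_⟧ k = lookup⁺ relations k

open Structure public

Distinct : ∀ {r} {A : Set} → (Fin r → A) → Set
Distinct a = ∀ i j → i ≢ j → a i ≢ a j

Irreflexive : ∀ {n r} → Relation n r → Set
Irreflexive {n} {r} R = (a : Tuple r n) → a ∈ᴿ R → Distinct a

Symmetric : ∀ {n r} → Relation n r → Set
Symmetric {n} {r} R =
  (a : Tuple r n) → a ∈ᴿ R → (π : Permutation′ r) → (a ∘ (π ⟨$⟩ʳ_)) ∈ᴿ R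

Colouring : ℕ → ℕ → Set
Colouring l n = Fin n → Fin l

module _ (l : ℕ) {L : Vocabulary} {n : ℕ} (M : Structure L n) where

  IsColouring : Colouring l n → Set
  IsColouring γ = ∀ k (a : Tuple (arity L k) n) → a ∈ᴿ ⟦ M ⟧ k →
                  ∃[ i ] ∃[ j ] γ (a i) ≢ γ (a j)

  IsStrongColouring : Colouring l n → Set
  IsStrongColouring γ = ∀ k (a : Tuple (arity L k) n) → a ∈ᴿ ⟦ M ⟧ k →
                        Distinct (γ ∘ a)

  Colourable : Set
  Colourable = ∃ IsColouring

  StronglyColourable : Set
  StronglyColourable = ∃ IsStrongColouring

IrreflexiveSymmetricOn : ∀ L {n} → Subset (ρ L) → Structure L n → Set
IrreflexiveSymmetricOn L I M =
  ∀ k → k ∈ I → Irreflexive (⟦ M ⟧ k) × Symmetric (⟦ M ⟧ k)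

𝐂 : ∀ l L → Subset (ρ L) → ∀ n → Pred (Structure L n) 0ℓ
𝐂 l L I n M = Colourable l M × IrreflexiveSymmetricOn L I M

𝐒 : ∀ l L → Subset (ρ L) → ∀ n → Pred (Structure L n) 0ℓ
𝐒 l L I n M = StronglyColourable l M × IrreflexiveSymmetricOn L I M

fibreSize : ∀ {l n} → Colouring l n → Fin l → ℕ
fibreSize {n = n} γ i = count (λ x → γ x ≟ i) (allFin n)

Rich : ∀ {l n} → ℚ → Colouring l n → Set
Rich α γ = ∀ i → α ≤ + fibreSize γ i / 1

module _ (l : ℕ) (L : Vocabulary) {n : ℕ} (α : ℚ) where

  HasNonRichColouring : Pred (Structure L n) 0ℓ
  HasNonRichColouring M = ∃[ γ ] IsColouring l M γ × ¬ Rich α γ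

  OnlyRichColourings : Pred (Structure L n) 0ℓ
  OnlyRichColourings M = ∀ γ → IsColouring l M γ → Rich α γ

  HasNonRichStrongColouring : Pred (Structure L n) 0ℓ
  HasNonRichStrongColouring M = ∃[ γ ] IsStrongColouring l M γ × ¬ Rich α γ

  OnlyRichStrongColourings : Pred (Structure L n) 0ℓ
  OnlyRichStrongColourings M = ∀ γ → IsStrongColouring l M γ → Rich α γ

subsets : ∀ n → List (Subset n)
subsets zero    = [] ∷ []
subsets (suc n) = cartesianProductWith _∷_ (inside ∷ outside ∷ []) (subsets n)

structuresOver : ∀ {ρ} n (rs : Vec ℕ ρ) → List (StructureOver n rs)
structuresOver n []       = [] ∷ []
structuresOver n (r ∷ rs) =
  cartesianProductWith _∷_ (map relation (subsets (n ^ r))) (structuresOver n rs)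

structures : ∀ L n → List (Structure L n)
structures L n = map structure (structuresOver n (arities L))

subsets-complete : ∀ {n} (S : Subset n) → S List.∈ subsets n
subsets-complete []            = here refl
subsets-complete (inside ∷ S)  =
  ∈-cartesianProductWith⁺ _∷_ {xs = inside ∷ outside ∷ []} (here refl) (subsets-complete S)
subsets-complete (outside ∷ S) =
  ∈-cartesianProductWith⁺ _∷_ {xs = inside ∷ outside ∷ []} (there (here refl)) (subsets-complete S)

structuresOver-complete : ∀ {ρ n} {rs : Vec ℕ ρ} (M : StructureOver n rs) →
                          M List.∈ structuresOver n rs
structuresOver-complete []      = here refl
structuresOver-complete (R ∷ M) =
  ∈-cartesianProductWith⁺ _∷_ (∈-map⁺ relation (subsets-complete (graph R))) (structuresOver-complete M)

structures-complete : ∀ L n (M : Structure L n) → M List.∈ structures L n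
structures-complete L n M = ∈-map⁺ structure (structuresOver-complete (relations M))

subsets-unique : ∀ n → Unique (subsets n)
subsets-unique zero    = ListAll.[] AllPairs.∷ AllPairs.[]
subsets-unique (suc n) =
  cartesianProductWith⁺ {xs = inside ∷ outside ∷ []} _∷_ (λ { refl → refl , refl })
    (((λ ()) ListAll.∷ ListAll.[]) AllPairs.∷ ListAll.[] AllPairs.∷ AllPairs.[])
    (subsets-unique n)

structuresOver-unique : ∀ {ρ} n (rs : Vec ℕ ρ) → Unique (structuresOver n rs)
structuresOver-unique n []       = ListAll.[] AllPairs.∷ AllPairs.[]
structuresOver-unique n (r ∷ rs) =
  cartesianProductWith⁺ _∷_ (λ { refl → refl , refl })
    (map⁺ (λ { refl → refl }) (subsets-unique (n ^ r))) (structuresOver-unique n rs)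

structures-unique : ∀ L n → Unique (structures L n)
structures-unique L n =
  map⁺ (λ { refl → refl }) (structuresOver-unique n (arities L))

funToFin-cong : ∀ {m n} {f g : Fin m → Fin n} → f ≗ g → funToFin f ≡ funToFin g
funToFin-cong {zero}  f≗g = refl
funToFin-cong {suc m} f≗g =
  cong₂ combine (f≗g Fin.zero) (funToFin-cong (f≗g ∘ Fin.suc))

Extensional : ∀ {m n} → Pred (Fin m → Fin n) 0ℓ → Set
Extensional P = ∀ {f g} → f ≗ g → P f → P g

∀fun? : ∀ {m n} {P : Pred (Fin m → Fin n) 0ℓ} →
        Extensional P → Decidable P → Dec (∀ f → P f)
∀fun? ext P? = map′ (λ h f → ext (finToFun-funToFin f) (h (funToFin f)))
                    (λ h c → h (finToFun c))
                    (all? (P? ∘ finToFun))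

∃fun? : ∀ {m n} {P : Pred (Fin m → Fin n) 0ℓ} →
        Extensional P → Decidable P → Dec (∃ P)
∃fun? ext P? = map′ (λ (c , p) → finToFun c , p)
                    (λ (f , p) → funToFin f , ext (sym ∘ finToFun-funToFin f) p)
                    (any? (P? ∘ finToFun))

∈ᴿ-ext : ∀ {n r} (R : Relation n r) → Extensional (_∈ᴿ R)
∈ᴿ-ext R f≗g = subst (_∈ graph R) (funToFin-cong f≗g)

distinct-ext : ∀ {m n} → Extensional (Distinct {m} {Fin n})
distinct-ext f≗g d i j i≢j gi≡gj =
  d i j i≢j (trans (f≗g i) (trans gi≡gj (sym (f≗g j))))

distinct? : ∀ {m n} → Decidable (Distinct {m} {Fin n})
distinct? a = all? λ i → all? λ j → ¬? (i ≟ j) →-dec ¬? (a i ≟ a j)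

irreflexive? : ∀ {n r} → Decidable (Irreflexive {n} {r})
irreflexive? R = ∀fun?
  (λ f≗g h → distinct-ext f≗g ∘ h ∘ ∈ᴿ-ext R (sym ∘ f≗g))
  (λ a → (funToFin a ∈? graph R) →-dec distinct? a)

perm? : ∀ {n r} (R : Relation n r) (a : Tuple r n) →
        Dec ((π : Permutation′ r) → (a ∘ (π ⟨$⟩ʳ_)) ∈ᴿ R)
perm? {n} {r} R a = map′
  (λ h π → h (π ⟨$⟩ʳ_) (π ⟨$⟩ˡ_) (λ i → inverseʳ π) (λ i → inverseˡ π))
  (λ h f g fg gf → h (permutation f g fg gf))
  (∀fun? ext₁ λ f → ∀fun? (ext₂ f) λ g →
    all? (λ i → f (g i) ≟ i) →-dec
    (all? (λ i → g (f i) ≟ i) →-dec (funToFin (a ∘ f) ∈? graph R)))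
  where
  Q : (f g : Fin r → Fin r) → Set
  Q f g = (∀ i → f (g i) ≡ i) → (∀ i → g (f i) ≡ i) → (a ∘ f) ∈ᴿ R

  ext₂ : ∀ f → Extensional (Q f)
  ext₂ f e q fg gf = q (λ i → trans (cong f (e i)) (fg i))
                       (λ i → trans (e (f i)) (gf i))

  ext₁ : Extensional (λ f → ∀ g → Q f g)
  ext₁ e q g fg gf = ∈ᴿ-ext R (cong a ∘ e)
    (q g (λ i → trans (e (g i)) (fg i)) (λ i → trans (cong g (e i)) (gf i)))

symmetric? : ∀ {n r} → Decidable (Symmetric {n} {r})
symmetric? R = ∀fun?
  (λ f≗g h g∈ π → ∈ᴿ-ext R (f≗g ∘ (π ⟨$⟩ʳ_)) (h (∈ᴿ-ext R (sym ∘ f≗g) g∈) π))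
  (λ a → (funToFin a ∈? graph R) →-dec perm? R a)

irreflexiveSymmetricOn? : ∀ L {n} I → Decidable (IrreflexiveSymmetricOn L {n} I)
irreflexiveSymmetricOn? L I M = all? λ k →
  (k ∈? I) →-dec (irreflexive? (⟦ M ⟧ k) ×-dec symmetric? (⟦ M ⟧ k))

rich? : ∀ {l n} α → Decidable (Rich {l} {n} α)
rich? α γ = all? λ i → α ≤?ℚ (+ fibreSize γ i / 1)

count-ext : ∀ {l n m} {γ δ : Colouring l n} → γ ≗ δ → ∀ i (xs : Vec (Fin n) m) →
            count (λ x → γ x ≟ i) xs ≡ count (λ x → δ x ≟ i) xs
count-ext e i [] = refl
count-ext e i (x ∷ xs) rewrite e x | count-ext e i xs = refl

rich-ext : ∀ {l n} α → Extensional (Rich {l} {n} α)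
rich-ext {n = n} α e h i =
  subst (λ c → α ≤ + c / 1) (count-ext e i (allFin n)) (h i)

module _ (l : ℕ) (L : Vocabulary) {n : ℕ} (M : Structure L n) where

  isColouring? : Decidable (IsColouring l M)
  isColouring? γ = all? λ k → ∀fun?
    (λ f≗g h g∈ → let i , j , ne = h (∈ᴿ-ext (⟦ M ⟧ k) (sym ∘ f≗g) g∈) in
       i , j , λ eq → ne (trans (cong γ (f≗g i)) (trans eq (cong γ (sym (f≗g j))))))
    (λ a → (funToFin a ∈? graph (⟦ M ⟧ k)) →-dec
           any? λ i → any? λ j → ¬? (γ (a i) ≟ γ (a j)))

  isColouring-ext : Extensional (IsColouring l M)
  isColouring-ext e h k a a∈ = let i , j , ne = h k a a∈ in
    i , j , λ eq → ne (trans (e (a i)) (trans eq (sym (e (a j)))))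

  isStrongColouring? : Decidable (IsStrongColouring l M)
  isStrongColouring? γ = all? λ k → ∀fun?
    (λ f≗g h → distinct-ext (cong γ ∘ f≗g) ∘ h ∘ ∈ᴿ-ext (⟦ M ⟧ k) (sym ∘ f≗g))
    (λ a → (funToFin a ∈? graph (⟦ M ⟧ k)) →-dec distinct? (γ ∘ a))

  isStrongColouring-ext : Extensional (IsStrongColouring l M)
  isStrongColouring-ext e h k a a∈ = distinct-ext (e ∘ a) (h k a a∈)

𝐂? : ∀ l L I n → Decidable (𝐂 l L I n)
𝐂? l L I n M = ∃fun? (isColouring-ext l L M) (isColouring? l L M)
               ×-dec irreflexiveSymmetricOn? L I M

𝐒? : ∀ l L I n → Decidable (𝐒 l L I n)
𝐒? l L I n M = ∃fun? (isStrongColouring-ext l L M) (isStrongColouring? l L M)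
               ×-dec irreflexiveSymmetricOn? L I M

module _ (l : ℕ) (L : Vocabulary) {n : ℕ} (α : ℚ) where

  hasNonRichColouring? : Decidable (HasNonRichColouring l L {n} α)
  hasNonRichColouring? M = ∃fun?
    (λ e (c , ¬r) → isColouring-ext l L M e c , ¬r ∘ rich-ext α (sym ∘ e))
    (λ γ → isColouring? l L M γ ×-dec ¬? (rich? α γ))

  onlyRichColourings? : Decidable (OnlyRichColourings l L {n} α)
  onlyRichColourings? M = ∀fun?
    (λ e h c → rich-ext α e (h (isColouring-ext l L M (sym ∘ e) c)))
    (λ γ → isColouring? l L M γ →-dec rich? α γ)

  hasNonRichStrongColouring? : Decidable (HasNonRichStrongColouring l L {n} α)
  hasNonRichStrongColouring? M = ∃fun?
    (λ e (c , ¬r) → isStrongColouring-ext l L M e c , ¬r ∘ rich-ext α (sym ∘ e))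
    (λ γ → isStrongColouring? l L M γ ×-dec ¬? (rich? α γ))

  onlyRichStrongColourings? : Decidable (OnlyRichStrongColourings l L {n} α)
  onlyRichStrongColourings? M = ∀fun?
    (λ e h c → rich-ext α e (h (isStrongColouring-ext l L M (sym ∘ e) c)))
    (λ γ → isStrongColouring? l L M γ →-dec rich? α γ)

card : ∀ {L n} {P : Pred (Structure L n) 0ℓ} → Decidable P → ℕ
card {L} {n} P? = length (filter P? (structures L n))

proportion : ∀ {L n} {P Q : Pred (Structure L n) 0ℓ}
             (P? : Decidable P) .{{_ : NonZero (card P?)}} → Decidable Q → ℚ
proportion P? Q? = + card (P? ∩? Q?) / card P?

emptyStructure : ∀ {ρ} n (rs : Vec ℕ ρ) → StructureOver n rs
emptyStructure n = VecAll.universal (λ _ → relation ∅)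

lookup-empty : ∀ {ρ} n (rs : Vec ℕ ρ) k → lookup⁺ (emptyStructure n rs) k ≡ relation ∅
lookup-empty n (r ∷ rs) Fin.zero    = refl
lookup-empty n (r ∷ rs) (Fin.suc k) = lookup-empty n rs k

no-tuples : ∀ L n k {x} {A : Set} →
            x ∈ graph (lookup⁺ (emptyStructure n (arities L)) k) → A
no-tuples L n k {x} x∈ =
  contradiction (subst (λ R → x ∈ graph R) (lookup-empty n (arities L) k) x∈) ∉⊥

someColouring : ∀ l .{{_ : NonTrivial l}} n → Colouring l n
someColouring (suc l) n _ = Fin.zero

card≢0 : ∀ L n {P : Pred (Structure L n) 0ℓ} (P? : Decidable P) {M} →
         P M → NonZero (card P?)
card≢0 L n P? {M} p = >-nonZero (∈-length (∈-filter⁺ P? (structures-complete L n M) p))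

card-𝐂≢0 : ∀ l .{{_ : NonTrivial l}} L I n → NonZero (card (𝐂? l L I n))
card-𝐂≢0 l L I n = card≢0 L n (𝐂? l L I n) {structure (emptyStructure n (arities L))}
  ( (someColouring l n , λ k a a∈ → no-tuples L n k a∈)
  , λ k _ → (λ a a∈ → no-tuples L n k a∈) , λ a a∈ → no-tuples L n k a∈)

card-𝐒≢0 : ∀ l .{{_ : NonTrivial l}} L I n → NonZero (card (𝐒? l L I n))
card-𝐒≢0 l L I n = card≢0 L n (𝐒? l L I n) {structure (emptyStructure n (arities L))}
  ( (someColouring l n , λ k a a∈ → no-tuples L n k a∈)
  , λ k _ → (λ a a∈ → no-tuples L n k a∈) , λ a a∈ → no-tuples L n k a∈)

proportion-𝐂 : ∀ l .{{_ : NonTrivial l}} L I n {Q : Pred (Structure L n) 0ℓ} →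
               Decidable Q → ℚ
proportion-𝐂 l L I n = proportion (𝐂? l L I n) {{card-𝐂≢0 l L I n}}

proportion-𝐒 : ∀ l .{{_ : NonTrivial l}} L I n {Q : Pred (Structure L n) 0ℓ} →
               Decidable Q → ℚ
proportion-𝐒 l L I n = proportion (𝐒? l L I n) {{card-𝐒≢0 l L I n}}

-- For x ≥ 0 and κ = p / q > 0, the inequality x ≤ 2^(-κ t) of reals, raised to
-- the power q and multiplied by 2^(p t).
infix 4 _≤2^-[_·_]
_≤2^-[_·_] : ℚ → ℚ → ℕ → Set
x ≤2^-[ κ · t ] = pow +-*-rawSemiring x (↧ₙ κ) * (+ (2 ^ (∣ ↥ κ ∣ℤ *ℕ t)) / 1) ≤ 1ℚ

Eventually : (ℕ → Set) → Set
Eventually P = ∃[ N ] ∀ n → N ≤ℕ n → P n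

infix 4 _⟶_
_⟶_ : (ℕ → ℚ) → ℚ → Set
x ⟶ y = ∀ ε → 0ℚ < ε → Eventually λ n → ∣ x n - y ∣ < ε

{-# OPTIONS --safe #-}
module Submission where

-- Let γ be a colouring whose class i is tiny.  Cut a block out of a class of
-- linear size and recolour it with i: few tuples stop being properly coloured,
-- since each of them has an entry in class i, while of the order of n ^ m tuples
-- (one entry from each of m disjoint blocks) become properly coloured.
-- Exchanging the former for the latter embeds {structures coloured by γ} ×
-- {sets of new tuples} into {structures coloured by γ′} × {sets of lost tuples},
-- so γ colours at most a 2 ^ (- λ n ^ m) fraction of all structures; relations of
-- smaller arity and the union over the l ^ n colourings cost only 2 ^ O(n ^ (m - 1)).
-- Closing the new tuples under permutations and exchanging whole orbits treats
-- symmetric and arbitrary relations alike.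

open import Defs
open import Data.Fin as Fin using (Fin; finToFun; funToFin; combine; remQuot; punchIn; punchOut; inject≤)
open import Data.Fin.Patterns using (0F; 1F)
open import Data.Fin.Permutation using (Permutation′; permutation; flip; _⟨$⟩ʳ_; _⟨$⟩ˡ_; inverseˡ; inverseʳ)
open import Data.Fin.Properties
  using (any?; all?; _≟_; ¬∀⟶∃¬; injective⇒≤; suc-injective; finToFun-funToFin; funToFin-finToFin;
         punchOut-injective; punchIn-punchOut; combine-injective; remQuot-combine; inject≤-injective)
open import Data.Fin.Subset using (Subset; inside; outside) renaming (_∈_ to _∈ₛ_; _⊆_ to _⊆ₛ_; ⊥ to ∅)
open import Data.Fin.Subset.Properties using (⊆-antisym; _∈?_; ∉⊥)
open import Data.List as List
  using (List; []; _∷_; _++_; filter; length; map; tabulate; allFin; cartesianProduct; cartesianProductWith)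
open import Data.List.Membership.Propositional using (_∈_)
open import Data.List.Membership.Propositional.Properties
  using (∈-filter⁺; ∈-filter⁻; ∈-cartesianProduct⁺; ∈-cartesianProduct⁻; ∈-lookup; ∈-map⁺; ∈-length; ∈-allFin)
open import Data.List.Properties
  using (filter-++; filter-all; length-++; length-map; length-filter; length-tabulate)
open import Data.List.Relation.Unary.All as ListAll using ()
open import Data.List.Relation.Unary.AllPairs as AllPairs using ()
open import Data.List.Relation.Unary.Any using (index)
open import Data.List.Relation.Unary.Any.Properties using (lookup-index)
open import Data.List.Relation.Unary.Unique.Propositional using (Unique)
open import Data.List.Relation.Unary.Unique.Propositional.Properties
  using (filter⁺; map⁺; cartesianProduct⁺; allFin⁺)
open import Data.Product using (∃; ∃-syntax; _×_; _,_; proj₁; proj₂)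
open import Data.Sum using (_⊎_; inj₁; inj₂)
open import Data.Vec as Vec using (Vec; []; _∷_; lookup)
open import Data.Vec.Functional using (insertAt)
open import Data.Vec.Functional.Properties using (insertAt-lookup; insertAt-punchIn)
open import Data.Vec.Properties using (lookup∘tabulate; []=⇒lookup; lookup⇒[]=)
open import Data.Vec.Relation.Unary.All using ([]; _∷_)
open import Data.Vec.Relation.Unary.All.Properties using (lookup⁺)
open import Function using (_∘_; id; const)
open import Function.Definitions using (Injective)
open import Level using (0ℓ)
open import Relation.Binary.PropositionalEquality
open import Relation.Nullary using (Dec; yes; no; does; ¬_; ¬?; contradiction)
open import Relation.Nullary.Decidable using (dec-true; decidable-stable; map′; _×-dec_; _⊎-dec_; _→-dec_)
open import Relation.Unary using (Pred; Decidable)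
open import Relation.Unary.Properties using (_∩?_)

-- The class of colourable structures is never counted. It contains every structure that `γ′`
-- colours, so comparing `γ` with a single `γ′` bounds the proportion. The obstacle is the strong
-- case. Producing rainbow tuples by moving part of one class to colour `i` relies on further large
-- classes, and `γ` may have too few of them. Then, however, every tuple that is rainbow for `γ`
-- contains an element of a light class. So all light elements are sacrificed, and `γ` is
-- overwritten on a long stretch by an even colouring. Some of the tuples supplied in this way may
-- have been rainbow before, but only if they contain a sacrificed element. This is why the exchange
-- is stated for a set `B` that need not be a colour class, and why it asks of the supplied tuples
-- only that they be badly coloured by `γ` or meet `B`. The order of the constants follows:
-- lightness is fixed first, so that all light elements together are few compared with the even
-- blocks; the bound for richness comes second and is small compared with a class that is not light.

module Combinatorics where

  open import Data.Nat hiding (_≟_)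
  open import Data.Nat.DivMod using (m/n*n≤m; m*n/n≡m; m≡m%n+[m/n]*n; m%n<n; /-mono-≤; n/n≡1)
  open import Data.Nat.Properties hiding (_≟_; suc-injective)
  open import Data.Nat.Tactic.RingSolver using (solve-∀)

  -- Counting with filtered lists and injections

  # : ∀ {A : Set} {P : Pred A 0ℓ} → Decidable P → List A → ℕ
  # P? xs = length (filter P? xs)

  lookup-injective : ∀ {A : Set} {xs : List A} → Unique xs → Injective _≡_ _≡_ (List.lookup xs)
  lookup-injective {xs = _ ∷ _} (x∉ AllPairs.∷ u) {Fin.zero}  {Fin.zero}  eq = refl
  lookup-injective {xs = _ ∷ _} (x∉ AllPairs.∷ u) {Fin.zero}  {Fin.suc j} eq =
    contradiction eq (ListAll.lookup x∉ (∈-lookup j))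
  lookup-injective {xs = _ ∷ _} (x∉ AllPairs.∷ u) {Fin.suc i} {Fin.zero}  eq =
    contradiction (sym eq) (ListAll.lookup x∉ (∈-lookup i))
  lookup-injective {xs = _ ∷ _} (x∉ AllPairs.∷ u) {Fin.suc i} {Fin.suc j} eq =
    cong Fin.suc (lookup-injective u eq)

  -- Injectivity is asked only on members of `xs`, because the exchange map can be inverted only on
  -- admissible relations.
  length-injection : ∀ {A B : Set} {xs : List A} {ys : List B} → Unique xs → (f : A → B) →
    (∀ {x} → x ∈ xs → f x ∈ ys) →
    (∀ {x y} → x ∈ xs → y ∈ xs → f x ≡ f y → x ≡ y) → length xs ≤ length ys
  length-injection {xs = xs} {ys} u f f∈ inj = injective⇒≤ {f = g} g-injective
    where
    g : Fin (length xs) → Fin (length ys)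
    g i = index (f∈ (∈-lookup i))

    lookup-g : ∀ i → List.lookup ys (g i) ≡ f (List.lookup xs i)
    lookup-g i = sym (lookup-index (f∈ (∈-lookup i)))

    g-injective : Injective _≡_ _≡_ g
    g-injective {i} {j} eq = lookup-injective u (inj (∈-lookup i) (∈-lookup j)
      (trans (sym (lookup-g i)) (trans (cong (List.lookup ys) eq) (lookup-g j))))

  length-cartesianProductWith : ∀ {A B C : Set} (f : A → B → C) xs ys →
    length (cartesianProductWith f xs ys) ≡ length xs * length ys
  length-cartesianProductWith f []       ys = refl
  length-cartesianProductWith f (x ∷ xs) ys = trans (length-++ (map (f x) ys))
    (cong₂ _+_ (length-map (f x) ys) (length-cartesianProductWith f xs ys))

  length-subsets : ∀ n → length (subsets n) ≡ 2 ^ n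
  length-subsets zero    = refl
  length-subsets (suc n) = trans
    (length-cartesianProductWith _∷_ (inside ∷ outside ∷ []) (subsets n))
    (cong (2 *_) (length-subsets n))

  module _ {A : Set} {P Q : Pred A 0ℓ} (P? : Decidable P) (Q? : Decidable Q) where

    #-mono : (∀ {x} → P x → Q x) → ∀ xs → # P? xs ≤ # Q? xs
    #-mono P⊆Q [] = z≤n
    #-mono P⊆Q (x ∷ xs) with P? x | Q? x
    ... | yes p | yes q = s≤s (#-mono P⊆Q xs)
    ... | yes p | no ¬q = contradiction (P⊆Q p) ¬q
    ... | no ¬p | yes q = m≤n⇒m≤1+n (#-mono P⊆Q xs)
    ... | no ¬p | no ¬q = #-mono P⊆Q xs

    #-subadditive : ∀ {R : Pred A 0ℓ} (R? : Decidable R) → (∀ {x} → R x → ¬ P x → Q x) →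
                    ∀ xs → # R? xs ≤ # P? xs + # Q? xs
    #-subadditive R? R⊆ [] = z≤n
    #-subadditive R? R⊆ (x ∷ xs) with ih ← #-subadditive R? R⊆ xs | R? x | P? x | Q? x
    ... | yes r | yes p | yes q = s≤s (≤-trans ih (+-monoʳ-≤ (# P? xs) (n≤1+n _)))
    ... | yes r | yes p | no ¬q = s≤s ih
    ... | yes r | no ¬p | yes q = ≤-trans (s≤s ih) (≤-reflexive (sym (+-suc _ _)))
    ... | yes r | no ¬p | no ¬q = contradiction (R⊆ r ¬p) ¬q
    ... | no ¬r | yes p | yes q = m≤n⇒m≤1+n (≤-trans ih (+-monoʳ-≤ (# P? xs) (n≤1+n _)))
    ... | no ¬r | yes p | no ¬q = m≤n⇒m≤1+n ih
    ... | no ¬r | no ¬p | yes q = ≤-trans ih (+-monoʳ-≤ (# P? xs) (n≤1+n _))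
    ... | no ¬r | no ¬p | no ¬q = ih

    #-partition : ∀ {R : Pred A 0ℓ} (R? : Decidable R) → (∀ {x} → R x → ¬ P x → Q x) →
                  (∀ {x} → P x → R x × ¬ Q x) → (∀ {x} → Q x → R x) →
                  ∀ xs → # P? xs + # Q? xs ≡ # R? xs
    #-partition R? R⊆ P⊆ Q⊆ [] = refl
    #-partition R? R⊆ P⊆ Q⊆ (x ∷ xs) with ih ← #-partition R? R⊆ P⊆ Q⊆ xs | R? x | P? x | Q? x
    ... | _     | yes p | yes q = contradiction q (proj₂ (P⊆ p))
    ... | no ¬r | yes p | no ¬q = contradiction (proj₁ (P⊆ p)) ¬r
    ... | yes r | yes p | no ¬q = cong suc ih
    ... | yes r | no ¬p | yes q = trans (+-suc _ _) (cong suc ih)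
    ... | yes r | no ¬p | no ¬q = contradiction (R⊆ r ¬p) ¬q
    ... | no ¬r | no ¬p | yes q = contradiction (Q⊆ q) ¬r
    ... | no ¬r | no ¬p | no ¬q = ih

  #-any : ∀ {A : Set} {N} {P : Fin N → Pred A 0ℓ} (P? : ∀ i → Decidable (P i)) {b} xs →
          (∀ i → # (P? i) xs ≤ b) → # (λ x → any? (λ i → P? i x)) xs ≤ N * b
  #-any {N = zero}  P? {b} xs ≤b = ≤-reflexive (none xs)
    where
    none : ∀ xs → # (λ x → any? (λ i → P? i x)) xs ≡ 0
    none []       = refl
    none (x ∷ xs) = none xs
  #-any {N = suc N} P? {b} xs ≤b = ≤-trans
    (#-subadditive (P? Fin.zero) (λ x → any? (λ i → P? (Fin.suc i) x)) _
      (λ { (Fin.zero , p) ¬p → contradiction p ¬p ; (Fin.suc i , p) _ → i , p }) xs)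
    (+-mono-≤ (≤b Fin.zero) (#-any (P? ∘ Fin.suc) xs (≤b ∘ Fin.suc)))

  #-map : ∀ {A B : Set} (f : A → B) {P : Pred A 0ℓ} {Q : Pred B 0ℓ}
          (P? : Decidable P) (Q? : Decidable Q) →
          (∀ {x} → P x → Q (f x)) → (∀ {x} → Q (f x) → P x) → ∀ xs →
          # Q? (map f xs) ≡ # P? xs
  #-map f P? Q? to from [] = refl
  #-map f P? Q? to from (x ∷ xs) with P? x | Q? (f x)
  ... | yes p | yes q = cong suc (#-map f P? Q? to from xs)
  ... | yes p | no ¬q = contradiction (to p) ¬q
  ... | no ¬p | yes q = contradiction (from q) ¬p
  ... | no ¬p | no ¬q = #-map f P? Q? to from xs

  #-none : ∀ {A : Set} {P : Pred A 0ℓ} (P? : Decidable P) → (∀ x → ¬ P x) → ∀ xs → # P? xs ≡ 0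
  #-none P? ¬P [] = refl
  #-none P? ¬P (x ∷ xs) with P? x
  ... | yes p = contradiction p (¬P x)
  ... | no _  = #-none P? ¬P xs

  #-product : ∀ {A B C : Set} (f : A → B → C) {P : Pred A 0ℓ} {Q : Pred B 0ℓ} {R : Pred C 0ℓ}
              (P? : Decidable P) (Q? : Decidable Q) (R? : Decidable R) →
              (∀ {x y} → P x → Q y → R (f x y)) → (∀ {x y} → R (f x y) → P x × Q y) →
              ∀ xs ys → # R? (cartesianProductWith f xs ys) ≡ # P? xs * # Q? ys
  #-product f P? Q? R? to from []       ys = refl
  #-product f P? Q? R? to from (x ∷ xs) ys = begin
    # R? (map (f x) ys ++ rest)           ≡⟨ cong length (filter-++ R? (map (f x) ys) rest) ⟩
    length (filter R? (map (f x) ys) ++ filter R? rest)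
                                          ≡⟨ length-++ (filter R? (map (f x) ys)) ⟩
    # R? (map (f x) ys) + # R? rest       ≡⟨ cong (# R? (map (f x) ys) +_)
                                                (#-product f P? Q? R? to from xs ys) ⟩
    # R? (map (f x) ys) + # P? xs * # Q? ys ≡⟨ row ⟩
    # P? (x ∷ xs) * # Q? ys               ∎
    where
    open ≡-Reasoning
    rest = cartesianProductWith f xs ys
    row : # R? (map (f x) ys) + # P? xs * # Q? ys ≡ # P? (x ∷ xs) * # Q? ys
    row with P? x
    ... | yes p = cong (_+ # P? xs * # Q? ys) (#-map (f x) Q? R? (to p) (proj₂ ∘ from) ys)
    ... | no ¬p = cong (_+ # P? xs * # Q? ys)
      (trans (#-map (f x) (λ y → R? (f x y)) R? id id ys)
             (#-none (λ y → R? (f x y)) (λ y → ¬p ∘ proj₁ ∘ from) ys))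

  -- Relations as decidable sets of tuples

  comprehension : ∀ {N} {P : Pred (Fin N) 0ℓ} → Decidable P → Subset N
  comprehension P? = Vec.tabulate (does ∘ P?)

  module _ {N} {P : Pred (Fin N) 0ℓ} (P? : Decidable P) where

    ∈-comprehension⁺ : ∀ {x} → P x → x ∈ₛ comprehension P?
    ∈-comprehension⁺ {x} p = lookup⇒[]= x _ (trans (lookup∘tabulate _ x) (dec-true (P? x) p))

    ∈-comprehension⁻ : ∀ {x} → x ∈ₛ comprehension P? → P x
    ∈-comprehension⁻ {x} x∈ with P? x | trans (sym (lookup∘tabulate (does ∘ P?) x)) ([]=⇒lookup x∈)
    ... | yes p | _ = p

  module _ {n r} {P : Pred (Tuple r n) 0ℓ} (P? : Decidable P) where

    ⟪_⟫ : Relation n r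
    ⟪_⟫ = relation (comprehension (P? ∘ finToFun))

    ∈⟪⟫⁺ : Extensional P → ∀ {a} → P a → a ∈ᴿ ⟪_⟫
    ∈⟪⟫⁺ ext {a} p = ∈-comprehension⁺ (P? ∘ finToFun) (ext (sym ∘ finToFun-funToFin a) p)

    ∈⟪⟫⁻ : Extensional P → ∀ {a} → a ∈ᴿ ⟪_⟫ → P a
    ∈⟪⟫⁻ ext {a} a∈ = ext (finToFun-funToFin a) (∈-comprehension⁻ (P? ∘ finToFun) a∈)

  _⊆ᴿ_ : ∀ {n r} → Relation n r → Relation n r → Set
  R ⊆ᴿ S = ∀ a → a ∈ᴿ R → a ∈ᴿ S

  ⊆ᴿ-antisym : ∀ {n r} {R S : Relation n r} → R ⊆ᴿ S → S ⊆ᴿ R → R ≡ S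
  ⊆ᴿ-antisym {n} {r} R⊆S S⊆R = cong relation (⊆-antisym (onGraphs R⊆S) (onGraphs S⊆R))
    where
    onGraphs : ∀ {R S : Relation n r} → R ⊆ᴿ S → graph R ⊆ₛ graph S
    onGraphs {R} {S} R⊆S {x} x∈ = subst (_∈ₛ graph S) (funToFin-finToFin {r} x)
      (R⊆S (finToFun x) (subst (_∈ₛ graph R) (sym (funToFin-finToFin {r} x)) x∈))

  injective⇒surjective : ∀ {m} {f : Fin m → Fin m} → Injective _≡_ _≡_ f → ∀ y → ∃[ x ] f x ≡ y
  injective⇒surjective {suc m} {f} inj y with any? (λ x → f x ≟ y)
  ... | yes hit  = hit
  ... | no  miss = contradiction (injective⇒≤ {f = λ x → punchOut (y≢f x)} (λ eq →
      inj (punchOut-injective (y≢f _) (y≢f _) eq))) 1+n≰n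
    where
    y≢f : ∀ x → y ≢ f x
    y≢f x y≡fx = miss (x , sym y≡fx)

  -- Exchanging tuples within one relation

  relations-on : ∀ n r → List (Relation n r)
  relations-on n r = map relation (subsets (n ^ r))

  relations-on-complete : ∀ {n r} (R : Relation n r) → R ∈ relations-on n r
  relations-on-complete R = ∈-map⁺ relation (subsets-complete (graph R))

  relations-on-unique : ∀ n r → Unique (relations-on n r)
  relations-on-unique n r = map⁺ (λ { refl → refl }) (subsets-unique (n ^ r))

  -- `Z` will be the proposition that the symbol belongs to `I`. As a hypothesis inside the record
  -- it lets arbitrary and irreflexive symmetric relations pass through the same exchange.
  record Admissible (Z : Set) {n r} (good : Pred (Tuple r n) 0ℓ) (R : Relation n r) : Set where
    constructor admissible
    field
      allGood    : ∀ a → a ∈ᴿ R → good a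
      irrefl×sym : Z → Irreflexive R × Symmetric R

  open Admissible

  -- `kept` lets all tuples avoiding `B` survive, `gained` allows any set of transversals of the
  -- blocks to be added, and `new` makes the added tuples recognisable afterwards: the old relation
  -- cannot have contained one that avoids `B`.
  module Exchange
    (Z : Set) {n m s : ℕ} (good good′ : Pred (Tuple (suc m) n) 0ℓ)
    (good-ext : Extensional good) (good′-ext : Extensional good′)
    (good-perm : ∀ {a} (π : Permutation′ (suc m)) → good a → good (a ∘ (π ⟨$⟩ʳ_)))
    (good′-perm : ∀ {a} (π : Permutation′ (suc m)) → good′ a → good′ (a ∘ (π ⟨$⟩ʳ_)))
    {B : Pred (Fin n) 0ℓ} (B? : Decidable B) (ys : List (Fin n)) (B⊆ys : ∀ {y} → B y → y ∈ ys)
    (e : Fin (suc m) → Fin s → Fin n)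
    (e-injective : ∀ {t x t′ x′} → e t x ≡ e t′ x′ → t ≡ t′ × x ≡ x′)
    (kept : ∀ {a} → good a → (∀ t → ¬ B (a t)) → good′ a)
    (gained : ∀ (u : Fin (suc m) → Fin s) → good′ (λ t → e t (u t)))
    (new : ∀ (u : Fin (suc m) → Fin s) → good (λ t → e t (u t)) → ∃[ t ] B (e t (u t)))
    where

    transversal : Fin (s ^ suc m) → Tuple (suc m) n
    transversal u t = e t (finToFun u t)

    infix 4 _⊒_
    -- The entries of a transversal are distinct, so a tuple of the same length that takes all of
    -- these values is a rearrangement of it. This form is decided without a search through
    -- permutations.
    _⊒_ : Tuple (suc m) n → Fin (s ^ suc m) → Set
    a ⊒ u = ∀ t → ∃[ p ] a p ≡ transversal u t

    ⊒-permutation : ∀ {a u} → a ⊒ u → ∃[ π ] (∀ t → a (π ⟨$⟩ʳ t) ≡ transversal u t)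
    ⊒-permutation {a} {u} h = permutation σ τ στ τσ , proj₂ ∘ h
      where
      σ : Fin (suc m) → Fin (suc m)
      σ = proj₁ ∘ h
      σ-injective : Injective _≡_ _≡_ σ
      σ-injective {t} {t′} eq = proj₁ (e-injective
        (trans (sym (proj₂ (h t))) (trans (cong a eq) (proj₂ (h t′)))))
      τ : Fin (suc m) → Fin (suc m)
      τ = proj₁ ∘ injective⇒surjective σ-injective
      στ : ∀ p → σ (τ p) ≡ p
      στ = proj₂ ∘ injective⇒surjective σ-injective
      τσ : ∀ t → τ (σ t) ≡ t
      τσ t = σ-injective (στ (σ t))

    -- The blocks are disjoint, so an entry reveals its position in the transversal; different
    -- transversals therefore have disjoint orbits.
    transversal-⊒⇒≡ : ∀ {u u′} → transversal u ⊒ u′ → u ≡ u′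
    transversal-⊒⇒≡ {u} {u′} h = begin
      u                                ≡⟨ funToFin-finToFin {suc m} {s} u ⟨
      funToFin (finToFun {s} {suc m} u)  ≡⟨ funToFin-cong same ⟩
      funToFin (finToFun {s} {suc m} u′) ≡⟨ funToFin-finToFin {suc m} {s} u′ ⟩
      u′                               ∎
      where
      open ≡-Reasoning
      same : finToFun u ≗ finToFun {s} {suc m} u′
      same t with h t
      ... | p , eq with e-injective eq
      ...   | refl , x≡x′ = x≡x′

    Hit : Pred (Tuple (suc m) n) 0ℓ
    Hit a = ∃[ t ] B (a t)

    hit? : Decidable Hit
    hit? a = any? (B? ∘ a)

    module _ (R : Relation n (suc m)) (U : Subset (s ^ suc m)) where

      Exchanged : Pred (Tuple (suc m) n) 0ℓ
      Exchanged a = (a ∈ᴿ R × ¬ Hit a) ⊎ (∃[ u ] u ∈ₛ U × a ⊒ u)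

      exchanged? : Decidable Exchanged
      exchanged? a = ((funToFin a ∈? graph R) ×-dec ¬? (hit? a)) ⊎-dec
        any? (λ u → (u ∈? U) ×-dec all? (λ t → any? (λ p → a p ≟ transversal u t)))

      exchanged-ext : Extensional Exchanged
      exchanged-ext f≗g (inj₁ (f∈ , ¬hit)) = inj₁ (∈ᴿ-ext R f≗g f∈ ,
        λ (t , b) → ¬hit (t , subst B (sym (f≗g t)) b))
      exchanged-ext f≗g (inj₂ (u , u∈ , h)) = inj₂ (u , u∈ ,
        λ t → proj₁ (h t) , trans (sym (f≗g _)) (proj₂ (h t)))

      exchanged : Relation n (suc m)
      exchanged = ⟪ exchanged? ⟫

    restTuple : Fin (suc m) → Fin (length ys) → Fin (n ^ m) → Tuple (suc m) n
    restTuple t j c = insertAt (finToFun c) t (List.lookup ys j)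

    -- The index of a tuple with an entry in B: a position, the entry there, and
    -- the remaining entries.
    hitTuple : Fin (suc m * (length ys * n ^ m)) → Tuple (suc m) n
    hitTuple v = let t , w = remQuot {suc m} (length ys * n ^ m) v
                     j , c = remQuot {length ys} (n ^ m) w in restTuple t j c

    hitTuple-combine : ∀ t j c → hitTuple (combine t (combine j c)) ≡ restTuple t j c
    hitTuple-combine t j c = trans
      (cong (λ (t , w) → let j , c = remQuot {length ys} (n ^ m) w in restTuple t j c)
            (remQuot-combine {suc m} t (combine j c)))
      (cong (λ (j , c) → restTuple t j c) (remQuot-combine {length ys} j c))

    hitTuple-surjective : ∀ {a} → Hit a → ∃[ v ] hitTuple v ≗ a
    hitTuple-surjective {a} (t , at∈B) = combine t (combine j c) , pointwise
      where
      j = index (B⊆ys at∈B)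
      c = funToFin (a ∘ punchIn t)
      pointwise : ∀ p → hitTuple (combine t (combine j c)) p ≡ a p
      pointwise p with t ≟ p
      ... | yes refl = trans (cong (λ f → f t) (hitTuple-combine t j c))
        (trans (insertAt-lookup (finToFun c) t _) (sym (lookup-index (B⊆ys at∈B))))
      ... | no  t≢p  = begin
        hitTuple (combine t (combine j c)) p        ≡⟨ cong (λ f → f p) (hitTuple-combine t j c) ⟩
        restTuple t j c p                           ≡⟨ cong (restTuple t j c) (punchIn-punchOut t≢p) ⟨
        restTuple t j c (punchIn t (punchOut t≢p))  ≡⟨ insertAt-punchIn (finToFun c) t _ (punchOut t≢p) ⟩
        finToFun c (punchOut t≢p)                   ≡⟨ finToFun-funToFin (a ∘ punchIn t) (punchOut t≢p) ⟩
        a (punchIn t (punchOut t≢p))                ≡⟨ cong a (punchIn-punchOut t≢p) ⟩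
        a p                                         ∎
        where open ≡-Reasoning

    -- A tuple with several entries in `B` is recorded several times. This is harmless: recovery
    -- needs an index for every such tuple, and the bound needs only the number of indices.
    hits : Relation n (suc m) → Subset (suc m * (length ys * n ^ m))
    hits R = comprehension (λ v → funToFin (hitTuple v) ∈? graph R)

    -- `Hit` and `_⊒_` ignore the order of entries, so both parts of the exchanged relation are
    -- closed under permutations; disjointness of the blocks makes the added tuples irreflexive.
    exchanged-admissible : ∀ {R} U → Admissible Z good R → Admissible Z good′ (exchanged R U)
    exchanged-admissible {R} U (admissible R-good R-is) = admissible
      (λ a a∈ → good′-all (from a∈))
      (λ z → let R-irr , R-sym = R-is z in
        (λ a a∈ → distinct R-irr (from a∈)) ,
        (λ a a∈ π → ∈⟪⟫⁺ (exchanged? R U) (exchanged-ext R U) (closed R-sym {a} π (from a∈))))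
      where
      from : ∀ {a} → a ∈ᴿ exchanged R U → Exchanged R U a
      from = ∈⟪⟫⁻ (exchanged? R U) (exchanged-ext R U)

      back : ∀ {a u} ((π , _) : ∃[ π ] (∀ t → a (π ⟨$⟩ʳ t) ≡ transversal u t)) →
             ∀ p → transversal u (π ⟨$⟩ˡ p) ≡ a p
      back {a} (π , eq) p = trans (sym (eq _)) (cong a (inverseʳ π))

      good′-all : ∀ {a} → Exchanged R U a → good′ a
      good′-all {a} (inj₁ (a∈ , ¬hit)) = kept (R-good a a∈) (λ t b → ¬hit (t , b))
      good′-all {a} (inj₂ (u , _ , h)) = good′-ext (back {u = u} (⊒-permutation {u = u} h))
        (good′-perm {transversal u} (flip (proj₁ (⊒-permutation {u = u} h))) (gained (finToFun u)))

      distinct : Irreflexive R → ∀ {a} → Exchanged R U a → Distinct a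
      distinct R-irr {a} (inj₁ (a∈ , _)) = R-irr a a∈
      distinct R-irr {a} (inj₂ (u , _ , h)) i j i≢j ai≡aj = i≢j (begin
        i                          ≡⟨ inverseʳ π ⟨
        π ⟨$⟩ʳ (π ⟨$⟩ˡ i)          ≡⟨ cong (π ⟨$⟩ʳ_) (proj₁ (e-injective
                                        (trans (back {u = u} w i) (trans ai≡aj (sym (back {u = u} w j)))))) ⟩
        π ⟨$⟩ʳ (π ⟨$⟩ˡ j)          ≡⟨ inverseʳ π ⟩
        j                          ∎)
        where
        open ≡-Reasoning
        w = ⊒-permutation {u = u} h
        π = proj₁ w

      closed : Symmetric R → ∀ {a} (π : Permutation′ (suc m)) →
               Exchanged R U a → Exchanged R U (a ∘ (π ⟨$⟩ʳ_))
      closed R-sym {a} π (inj₁ (a∈ , ¬hit)) = inj₁ (R-sym a a∈ π , λ (t , b) → ¬hit (π ⟨$⟩ʳ t , b))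
      closed R-sym {a} π (inj₂ (u , u∈ , h)) = inj₂ (u , u∈ , λ t →
        π ⟨$⟩ˡ proj₁ (h t) , trans (cong a (inverseʳ π)) (proj₂ (h t)))

    -- A tuple of R without an entry in B is never a rearranged transversal, so
    -- the two parts of exchanged R U can be told apart.
    separated : ∀ {R a u} → Admissible Z good R → a ∈ᴿ R → ¬ Hit a → ¬ (a ⊒ u)
    separated {R} {a} {u} adm a∈ ¬hit h = ¬hit (proj₁ (h t) , subst B (sym (proj₂ (h t))) b)
      where
      w = ⊒-permutation {u = u} h
      hit : Hit (transversal u)
      hit = new (finToFun u) (good-ext (proj₂ w) (good-perm {a} (proj₁ w) (allGood adm a a∈)))
      t = proj₁ hit
      b = proj₂ hit

    module _ {R S U W} (R-adm : Admissible Z good R) (S-adm : Admissible Z good S)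
             (ex≡ : exchanged R U ≡ exchanged S W) (hits≡ : hits R ≡ hits S) where

      transfer : ∀ {a} → Exchanged R U a → Exchanged S W a
      transfer {a} = ∈⟪⟫⁻ (exchanged? S W) (exchanged-ext S W) ∘ subst (a ∈ᴿ_) ex≡
                     ∘ ∈⟪⟫⁺ (exchanged? R U) (exchanged-ext R U)

      -- By `separated` a transversal in the exchanged relation cannot stem from `S`, so it comes
      -- from `W`, where its orbit determines it.
      recover-U : U ⊆ₛ W
      recover-U {u} u∈ with transfer (inj₂ (u , u∈ , λ t → t , refl))
      ... | inj₁ (a∈ , ¬hit)  = contradiction (λ t → t , refl) (separated {u = u} S-adm a∈ ¬hit)
      ... | inj₂ (u′ , u′∈ , h) = subst (_∈ₛ W) (sym (transversal-⊒⇒≡ h)) u′∈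

      -- Membership of a tuple meeting `B` is read off from `hits`. Any other tuple of `R` survives
      -- the exchange, and by `separated` it is not one of the added ones.
      recover-R : R ⊆ᴿ S
      recover-R a a∈ with hit? a
      ... | yes hit with hitTuple-surjective hit
      ...   | v , eq = ∈ᴿ-ext S eq (∈-comprehension⁻ (λ v → funToFin (hitTuple v) ∈? graph S)
                (subst (v ∈ₛ_) hits≡ (∈-comprehension⁺ (λ v → funToFin (hitTuple v) ∈? graph R)
                  (∈ᴿ-ext R (sym ∘ eq) a∈))))
      recover-R a a∈ | no ¬hit with transfer (inj₁ (a∈ , ¬hit))
      ...   | inj₁ (a∈S , _) = a∈S
      ...   | inj₂ (u , _ , h) = contradiction h (separated {u = u} R-adm a∈ ¬hit)

    exchange : (P? : Decidable (Admissible Z good)) (P′? : Decidable (Admissible Z good′)) →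
      # P? (relations-on n (suc m)) * 2 ^ (s ^ suc m) ≤
      # P′? (relations-on n (suc m)) * 2 ^ (suc m * (length ys * n ^ m))
    exchange P? P′? = subst₂ _≤_
      (sizes (filter P? (relations-on n (suc m))) (s ^ suc m))
      (sizes (filter P′? (relations-on n (suc m))) (suc m * (length ys * n ^ m)))
      (length-injection
        (cartesianProduct⁺ (filter⁺ P? (relations-on-unique n (suc m))) (subsets-unique _))
        (λ (R , U) → exchanged R U , hits R)
        (λ {(R , U)} RU∈ → ∈-cartesianProduct⁺
          (∈-filter⁺ P′? (relations-on-complete _) (exchanged-admissible U (adm RU∈)))
          (subsets-complete _))
        (λ {(R , U)} {(S , W)} RU∈ SW∈ eq →
          let ex≡ = cong proj₁ eq ; hits≡ = cong proj₂ eq in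
          cong₂ _,_
            (⊆ᴿ-antisym (recover-R (adm RU∈) (adm SW∈) ex≡ hits≡)
                        (recover-R (adm SW∈) (adm RU∈) (sym ex≡) (sym hits≡)))
            (⊆-antisym (recover-U (adm RU∈) (adm SW∈) ex≡ hits≡)
                       (recover-U (adm SW∈) (adm RU∈) (sym ex≡) (sym hits≡)))))
      where
      adm : ∀ {RU} → RU ∈ cartesianProduct (filter P? (relations-on n (suc m))) (subsets (s ^ suc m)) →
            Admissible Z good (proj₁ RU)
      adm RU∈ = proj₂ (∈-filter⁻ P? {xs = relations-on n (suc m)} (proj₁ (∈-cartesianProduct⁻ _ _ RU∈)))

      sizes : (Rs : List (Relation n (suc m))) → ∀ N →
              length (cartesianProduct Rs (subsets N)) ≡ length Rs * 2 ^ N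
      sizes Rs N = trans (length-cartesianProductWith _,_ Rs (subsets N))
                         (cong (length Rs *_) (length-subsets N))

  -- From single relations to structures

  module _ {n : ℕ} where

    AllRelations : ∀ {ρ} {rs : Vec ℕ ρ} → (∀ k → Pred (Relation n (lookup rs k)) 0ℓ) →
                   Pred (StructureOver n rs) 0ℓ
    AllRelations P M = ∀ k → P k (lookup⁺ M k)

    allRelations? : ∀ {ρ} {rs : Vec ℕ ρ} {P : ∀ k → Pred (Relation n (lookup rs k)) 0ℓ} →
                    (∀ k → Decidable (P k)) → Decidable (AllRelations {rs = rs} P)
    allRelations? P? M = all? λ k → P? k (lookup⁺ M k)

    #-∷ : ∀ {ρ r} {rs : Vec ℕ ρ} {P : ∀ k → Pred (Relation n (lookup (r ∷ rs) k)) 0ℓ}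
          (P? : ∀ k → Decidable (P k)) →
          # (allRelations? {rs = r ∷ rs} P?) (structuresOver n (r ∷ rs)) ≡
          # (P? Fin.zero) (relations-on n r) *
          # (allRelations? {rs = rs} (P? ∘ Fin.suc)) (structuresOver n rs)
    #-∷ {r = r} {rs} {P} P? = #-product _∷_ (P? Fin.zero)
      (allRelations? {rs = rs} (P? ∘ Fin.suc)) (allRelations? {rs = r ∷ rs} P?)
      (λ { p q Fin.zero → p ; p q (Fin.suc k) → q k })
      (λ h → h Fin.zero , h ∘ Fin.suc)
      (relations-on n r) (structuresOver n rs)

    #-structures-mono : ∀ {ρ} (rs : Vec ℕ ρ) {P Q : ∀ k → Pred (Relation n (lookup rs k)) 0ℓ}
      (P? : ∀ k → Decidable (P k)) (Q? : ∀ k → Decidable (Q k)) {h} →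
      (∀ k → # (P? k) (relations-on n (lookup rs k)) ≤ # (Q? k) (relations-on n (lookup rs k)) * 2 ^ h) →
      # (allRelations? {rs = rs} P?) (structuresOver n rs) ≤
      # (allRelations? {rs = rs} Q?) (structuresOver n rs) * 2 ^ (ρ * h)
    #-structures-mono []       P? Q? {h} P≤Q = ≤-trans
      (#-mono (allRelations? {rs = []} P?) (allRelations? {rs = []} Q?) (λ _ ()) (structuresOver n []))
      (≤-reflexive (sym (*-identityʳ _)))
    #-structures-mono {suc ρ} (r ∷ rs) P? Q? {h} P≤Q = begin
      # (allRelations? {rs = r ∷ rs} P?) (structuresOver n (r ∷ rs))  ≡⟨ #-∷ P? ⟩
      p * ps                          ≤⟨ *-mono-≤ (P≤Q Fin.zero)
                                           (#-structures-mono rs (P? ∘ Fin.suc) (Q? ∘ Fin.suc) (P≤Q ∘ Fin.suc)) ⟩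
      q * 2 ^ h * (qs * 2 ^ (ρ * h))  ≡⟨ [m*n]*[o*p]≡[m*o]*[n*p] q (2 ^ h) qs _ ⟩
      q * qs * (2 ^ h * 2 ^ (ρ * h))  ≡⟨ cong₂ _*_ (sym (#-∷ Q?)) (sym (^-distribˡ-+-* 2 h (ρ * h))) ⟩
      # (allRelations? {rs = r ∷ rs} Q?) (structuresOver n (r ∷ rs)) * 2 ^ (suc ρ * h) ∎
      where
      open ≤-Reasoning
      p = # (P? Fin.zero) (relations-on n r)
      q = # (Q? Fin.zero) (relations-on n r)
      ps = # (allRelations? {rs = rs} (P? ∘ Fin.suc)) (structuresOver n rs)
      qs = # (allRelations? {rs = rs} (Q? ∘ Fin.suc)) (structuresOver n rs)

    #-structures-gain : ∀ {ρ} (rs : Vec ℕ ρ) {P Q : ∀ k → Pred (Relation n (lookup rs k)) 0ℓ}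
      (P? : ∀ k → Decidable (P k)) (Q? : ∀ k → Decidable (Q k)) {g h} →
      (∀ k → # (P? k) (relations-on n (lookup rs k)) ≤ # (Q? k) (relations-on n (lookup rs k)) * 2 ^ h) →
      ∀ k → # (P? k) (relations-on n (lookup rs k)) * 2 ^ g ≤
            # (Q? k) (relations-on n (lookup rs k)) * 2 ^ h →
      # (allRelations? {rs = rs} P?) (structuresOver n rs) * 2 ^ g ≤
      # (allRelations? {rs = rs} Q?) (structuresOver n rs) * 2 ^ (ρ * h)
    #-structures-gain {suc ρ} (r ∷ rs) P? Q? {g} {h} P≤Q k gain = begin
      # (allRelations? {rs = r ∷ rs} P?) (structuresOver n (r ∷ rs)) * 2 ^ g
                                      ≡⟨ cong (_* 2 ^ g) (#-∷ P?) ⟩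
      p * ps * 2 ^ g                  ≤⟨ step k gain ⟩
      q * 2 ^ h * (qs * 2 ^ (ρ * h))  ≡⟨ [m*n]*[o*p]≡[m*o]*[n*p] q (2 ^ h) qs _ ⟩
      q * qs * (2 ^ h * 2 ^ (ρ * h))  ≡⟨ cong₂ _*_ (sym (#-∷ Q?)) (sym (^-distribˡ-+-* 2 h (ρ * h))) ⟩
      # (allRelations? {rs = r ∷ rs} Q?) (structuresOver n (r ∷ rs)) * 2 ^ (suc ρ * h) ∎
      where
      open ≤-Reasoning
      p = # (P? Fin.zero) (relations-on n r)
      q = # (Q? Fin.zero) (relations-on n r)
      ps = # (allRelations? {rs = rs} (P? ∘ Fin.suc)) (structuresOver n rs)
      qs = # (allRelations? {rs = rs} (Q? ∘ Fin.suc)) (structuresOver n rs)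
      -- The number of structures is a product over the symbols: the factor of symbol `k` absorbs
      -- `2 ^ g`, and every factor costs at most `2 ^ h`.
      step : ∀ k → # (P? k) (relations-on n (lookup (r ∷ rs) k)) * 2 ^ g ≤
                   # (Q? k) (relations-on n (lookup (r ∷ rs) k)) * 2 ^ h →
             p * ps * 2 ^ g ≤ q * 2 ^ h * (qs * 2 ^ (ρ * h))
      step Fin.zero gain = begin
        p * ps * 2 ^ g                  ≡⟨ [m*n]*o≡[m*o]*n p ps _ ⟩
        p * 2 ^ g * ps                  ≤⟨ *-mono-≤ gain
                                             (#-structures-mono rs (P? ∘ Fin.suc) (Q? ∘ Fin.suc) (P≤Q ∘ Fin.suc)) ⟩
        q * 2 ^ h * (qs * 2 ^ (ρ * h))  ∎
        where
        [m*n]*o≡[m*o]*n : ∀ m n o → m * n * o ≡ m * o * n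
        [m*n]*o≡[m*o]*n = solve-∀
      step (Fin.suc k) gain = begin
        p * ps * 2 ^ g                  ≡⟨ *-assoc p ps _ ⟩
        p * (ps * 2 ^ g)                ≤⟨ *-mono-≤ (P≤Q Fin.zero)
                                             (#-structures-gain rs (P? ∘ Fin.suc) (Q? ∘ Fin.suc) {g} (P≤Q ∘ Fin.suc) k gain) ⟩
        q * 2 ^ h * (qs * 2 ^ (ρ * h))  ∎

  -- Colour rules and the gain from an improved colouring

  admissible? : ∀ {Z : Set} (Z? : Dec Z) {n r} {good : Pred (Tuple r n) 0ℓ} →
                Extensional good → Decidable good → Decidable (Admissible Z good)
  admissible? Z? good-ext good? R = map′ (λ (g , z) → admissible g z) (λ (admissible g z) → g , z)
    (∀fun? (λ f≗g h g∈ → good-ext f≗g (h (∈ᴿ-ext R (sym ∘ f≗g) g∈)))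
           (λ a → (funToFin a ∈? graph R) →-dec good? a)
     ×-dec (Z? →-dec (irreflexive? R ×-dec symmetric? R)))

  empty-admissible : ∀ {Z : Set} {n r} {good : Pred (Tuple r n) 0ℓ} → Admissible Z good (relation ∅)
  empty-admissible = admissible (λ _ a∈ → contradiction a∈ ∉⊥)
    (λ _ → (λ _ a∈ → contradiction a∈ ∉⊥) , (λ _ a∈ → contradiction a∈ ∉⊥))

  -- Both notions of colouring constrain the colour pattern of one tuple at a time, regardless of
  -- the order of its entries. Apart from the choice of `γ′`, the argument uses nothing else.
  record ColourRule (l : ℕ) : Set₁ where
    field
      good      : ∀ {r} → Pred (Fin r → Fin l) 0ℓ
      good?     : ∀ {r} → Decidable (good {r})
      good-ext  : ∀ {r} → Extensional (good {r})
      good-perm : ∀ {r} {c : Fin r → Fin l} (π : Permutation′ r) → good c → good (c ∘ (π ⟨$⟩ʳ_))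

    Obeys : ∀ {n L} → Colouring l n → Structure L n → Set
    Obeys {L = L} γ M = ∀ k (a : Tuple (arity L k) _) → a ∈ᴿ ⟦ M ⟧ k → good (γ ∘ a)

  -- `new` is weaker than saying that `γ` colours every transversal badly; the even colouring needs
  -- this freedom.
  record Improvement {l} (C : ColourRule l) {n : ℕ} (m s b : ℕ) (γ : Colouring l n) : Set₁ where
    open ColourRule C
    field
      γ′          : Colouring l n
      B           : Pred (Fin n) 0ℓ
      B?          : Decidable B
      cover       : List (Fin n)
      B⊆cover     : ∀ {y} → B y → y ∈ cover
      cover≤      : length cover ≤ b
      e           : Fin m → Fin s → Fin n
      e-injective : ∀ {t x t′ x′} → e t x ≡ e t′ x′ → t ≡ t′ × x ≡ x′
      kept        : ∀ {a : Tuple m n} → good (γ ∘ a) → (∀ t → ¬ B (a t)) → good (γ′ ∘ a)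
      gained      : ∀ (u : Fin m → Fin s) → good (λ t → γ′ (e t (u t)))
      new         : ∀ (u : Fin m → Fin s) → good (λ t → γ (e t (u t))) → ∃[ t ] B (e t (u t))

  module _ {l} (C : ColourRule l) (L : Vocabulary) (I : Subset (ρ L)) {n : ℕ} where

    open ColourRule C

    RelationFits : Colouring l n → ∀ k → Pred (Relation n (arity L k)) 0ℓ
    RelationFits γ k = Admissible (k ∈ₛ I) (good ∘ (γ ∘_))

    goodFor-ext : ∀ (γ : Colouring l n) {r} → Extensional {r} (good ∘ (γ ∘_))
    goodFor-ext γ f≗g = good-ext (cong γ ∘ f≗g)

    relationFits? : ∀ γ k → Decidable (RelationFits γ k)
    relationFits? γ k = admissible? (k ∈? I) (goodFor-ext γ) (good? ∘ (γ ∘_))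

    Fits : Colouring l n → Pred (Structure L n) 0ℓ
    Fits γ M = Obeys γ M × IrreflexiveSymmetricOn L I M

    fits? : ∀ γ → Decidable (Fits γ)
    fits? γ M = map′ (λ h → (λ k → Admissible.allGood (h k)) , (λ k → Admissible.irrefl×sym (h k)))
      (λ (o , i) k → admissible (o k) (i k)) (allRelations? (relationFits? γ) (relations M))

    #-fits : ∀ γ → # (fits? γ) (structures L n) ≡
                   # (allRelations? (relationFits? γ)) (structuresOver n (arities L))
    #-fits γ = #-map structure (allRelations? (relationFits? γ)) (fits? γ)
      (λ h → (λ k → Admissible.allGood (h k)) , (λ k → Admissible.irrefl×sym (h k)))
      (λ (o , i) k → admissible (o k) (i k)) (structuresOver n (arities L))

    module _ .{{_ : NonZero n}} {m s b} {γ : Colouring l n} (imp : Improvement C (suc m) s b γ) where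

      open Improvement imp

      -- The first summand is the number of indices for lost tuples of arity `suc m`. The second
      -- pays for discarding a whole relation of smaller arity.
      slack : ℕ
      slack = suc m * (b * n ^ m) + n ^ m

      relation-gain : ∀ {Z : Set} {r} → r ≡ suc m →
        (P? : Decidable (Admissible Z {n} {r} (good ∘ (γ ∘_))))
        (P′? : Decidable (Admissible Z (good ∘ (γ′ ∘_)))) →
        # P? (relations-on n r) * 2 ^ (s ^ suc m) ≤ # P′? (relations-on n r) * 2 ^ slack
      relation-gain {Z} refl P? P′? = ≤-trans
        (exchange P? P′?)
        (*-monoʳ-≤ (# P′? (relations-on n (suc m))) (^-monoʳ-≤ 2 (≤-trans
          (*-monoʳ-≤ (suc m) (*-monoˡ-≤ (n ^ m) cover≤)) (m≤m+n _ _))))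
        where
        open Exchange Z (good ∘ (γ ∘_)) (good ∘ (γ′ ∘_)) (goodFor-ext γ) (goodFor-ext γ′)
          good-perm good-perm B? cover B⊆cover e e-injective kept gained new

      -- The last alternative covers strong colourings and arities above `l`: there the relation is
      -- forced to be empty, and passing from `γ` to `γ′` costs nothing.
      Small : ℕ → Set
      Small r = r ≤ m ⊎ r ≡ suc m ⊎ (∀ (c : Fin r → Fin l) → ¬ good c)

      relation-mono : ∀ {Z : Set} {r} → Small r →
        (P? : Decidable (Admissible Z {n} {r} (good ∘ (γ ∘_))))
        (P′? : Decidable (Admissible Z (good ∘ (γ′ ∘_)))) →
        # P? (relations-on n r) ≤ # P′? (relations-on n r) * 2 ^ slack
      relation-mono {r = r} (inj₁ r≤m) P? P′? = begin
        # P? (relations-on n r)       ≤⟨ length-filter P? (relations-on n r) ⟩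
        length (relations-on n r)     ≡⟨ trans (length-map (relation {n} {r}) (subsets (n ^ r)))
                                               (length-subsets (n ^ r)) ⟩
        2 ^ (n ^ r)                   ≤⟨ ^-monoʳ-≤ 2 (≤-trans (^-monoʳ-≤ n r≤m)
                                           (m≤n+m (n ^ m) (suc m * (b * n ^ m)))) ⟩
        2 ^ slack                     ≡⟨ *-identityˡ _ ⟨
        -- The empty relation is admissible for `γ′`, so the count on the right is at least 1.
        1 * 2 ^ slack                 ≤⟨ *-monoˡ-≤ (2 ^ slack) (∈-length
                                           (∈-filter⁺ P′? (relations-on-complete (relation ∅)) empty-admissible)) ⟩
        # P′? (relations-on n r) * 2 ^ slack ∎
        where open ≤-Reasoning
      relation-mono (inj₂ (inj₁ r≡)) P? P′? = ≤-trans
        (m≤m*n _ (2 ^ (s ^ suc m)) {{m^n≢0 2 (s ^ suc m)}}) (relation-gain r≡ P? P′?)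
      relation-mono {r = r} (inj₂ (inj₂ bad)) P? P′? = ≤-trans
        (#-mono P? P′? (λ (admissible g i) → admissible (λ a a∈ → contradiction (g a a∈) (bad _)) i)
                (relations-on n r))
        (m≤m*n _ (2 ^ slack) {{m^n≢0 2 slack}})

      structures-gain : (∀ k → Small (arity L k)) → ∀ k → arity L k ≡ suc m →
        # (fits? γ) (structures L n) * 2 ^ (s ^ suc m) ≤ # (fits? γ′) (structures L n) * 2 ^ (ρ L * slack)
      structures-gain small k k≡ = subst₂ (λ x y → x * 2 ^ (s ^ suc m) ≤ y * 2 ^ (ρ L * slack))
        (sym (#-fits γ)) (sym (#-fits γ′))
        (#-structures-gain (arities L) (relationFits? γ) (relationFits? γ′) {s ^ suc m}
          (λ k → relation-mono (small k) (relationFits? γ k) (relationFits? γ′ k))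
          k (relation-gain k≡ (relationFits? γ k) (relationFits? γ′ k)))

    module _ {Bad : Pred (Colouring l n) 0ℓ} (Bad? : Decidable Bad) (Bad-ext : Extensional Bad)
             {K X : Pred (Structure L n) 0ℓ} (K? : Decidable K) (X? : Decidable X)
             (X⊆ : ∀ {M} → X M → ∃[ γ ] Bad γ × Fits γ M) where

      -- A union bound over the l ^ n colourings, after which l ^ n ≤ 2 ^ (l * n)
      -- is absorbed by the exponent.
      bad-colourings-rare : ∀ E →
        (∀ γ → Bad γ → # (fits? γ) (structures L n) * 2 ^ (E + l * n) ≤ # K? (structures L n)) →
        # X? (structures L n) * 2 ^ E ≤ # K? (structures L n)
      bad-colourings-rare E rare = *-cancelʳ-≤ _ _ (2 ^ (l * n)) {{m^n≢0 2 (l * n)}} (begin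
        x * 2 ^ E * 2 ^ (l * n)       ≡⟨ *-assoc x _ _ ⟩
        x * (2 ^ E * 2 ^ (l * n))     ≡⟨ cong (x *_) (^-distribˡ-+-* 2 E (l * n)) ⟨
        x * 2 ^ (E + l * n)           ≤⟨ *-monoˡ-≤ _ (≤-trans union (#-any per? (structures L n) each)) ⟩
        l ^ n * (k / d) * d           ≡⟨ *-assoc (l ^ n) _ _ ⟩
        l ^ n * (k / d * d)           ≤⟨ *-mono-≤ l^n≤ (m/n*n≤m k d) ⟩
        2 ^ (l * n) * k               ≡⟨ *-comm _ k ⟩
        k * 2 ^ (l * n)               ∎)
        where
        open ≤-Reasoning
        d = 2 ^ (E + l * n)
        instance
          d≢0 : NonZero d
          d≢0 = m^n≢0 2 (E + l * n)
        x = # X? (structures L n)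
        k = # K? (structures L n)

        per? : ∀ (c : Fin (l ^ n)) → Decidable (λ M → Bad (finToFun c) × Fits (finToFun c) M)
        per? c M = Bad? (finToFun c) ×-dec fits? (finToFun c) M

        union : x ≤ # (λ M → any? (λ c → per? c M)) (structures L n)
        union = #-mono X? _ (λ xM → let γ , bad , o , i = X⊆ xM in
          funToFin γ , Bad-ext (sym ∘ finToFun-funToFin γ) bad ,
          (λ k a a∈ → good-ext (λ p → sym (finToFun-funToFin γ (a p))) (o k a a∈)) , i)
          (structures L n)

        -- The union bound takes one natural number that bounds all the counts, hence the quotient
        -- rounded down; it is multiplied back by `d` afterwards.
        each : ∀ c → # (per? c) (structures L n) ≤ k / d
        each c with Bad? (finToFun c)
        ... | no ¬bad = ≤-trans
          (≤-reflexive (#-none (λ M → no ¬bad ×-dec fits? (finToFun c) M) (λ _ → ¬bad ∘ proj₁) (structures L n)))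
          z≤n
        ... | yes bad = begin
          # (λ M → yes bad ×-dec fits? (finToFun c) M) (structures L n)
                         ≤⟨ #-mono _ (fits? (finToFun c)) proj₂ (structures L n) ⟩
          f              ≡⟨ m*n/n≡m f d ⟨
          f * d / d      ≤⟨ /-mono-≤ (rare (finToFun c) bad) (≤-refl {d}) ⟩
          k / d          ∎
          where f = # (fits? (finToFun c)) (structures L n)

        l≤2^l : ∀ l → l ≤ 2 ^ l
        l≤2^l zero    = z≤n
        l≤2^l (suc l) = ≤-trans (+-mono-≤ (m^n>0 2 l) (l≤2^l l)) (+-monoʳ-≤ (2 ^ l) (m≤m+n _ _))

        l^n≤ : l ^ n ≤ 2 ^ (l * n)
        l^n≤ = ≤-trans (^-monoˡ-≤ n (l≤2^l l)) (≤-reflexive (^-*-assoc 2 l n))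

  -- Colour classes and recolouring

  module _ {l n : ℕ} (γ : Colouring l n) where

    colourClass : Fin l → List (Fin n)
    colourClass c = filter (λ x → γ x ≟ c) (allFin n)

    colourClass-unique : ∀ c → Unique (colourClass c)
    colourClass-unique c = filter⁺ (λ x → γ x ≟ c) (allFin⁺ n)

    ∈-colourClass⁺ : ∀ {c x} → γ x ≡ c → x ∈ colourClass c
    ∈-colourClass⁺ {c} {x} = ∈-filter⁺ (λ x → γ x ≟ c) (∈-allFin x)

    ∈-colourClass⁻ : ∀ {c x} → x ∈ colourClass c → γ x ≡ c
    ∈-colourClass⁻ {c} x∈ = proj₂ (∈-filter⁻ (λ x → γ x ≟ c) {xs = allFin n} x∈)

    fibreSize≡length : ∀ c → fibreSize γ c ≡ length (colourClass c)
    fibreSize≡length c = go id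
      where
      go : ∀ {m} (f : Fin m → Fin n) →
           Vec.count (λ x → γ x ≟ c) (Vec.tabulate f) ≡ # (λ x → γ x ≟ c) (tabulate f)
      go {zero}  f = refl
      go {suc m} f with γ (f Fin.zero) ≟ c
      ... | yes _ = cong suc (go (f ∘ Fin.suc))
      ... | no  _ = go (f ∘ Fin.suc)

    #-light : ∀ τ → # (λ x → length (colourClass (γ x)) ≤? τ) (allFin n) ≤ l * τ
    #-light τ = ≤-trans
      (#-mono (λ x → length (colourClass (γ x)) ≤? τ)
              (λ x → any? λ c → (γ x ≟ c) ×-dec (length (colourClass c) ≤? τ))
        (λ light → γ _ , refl , light) (allFin n))
      (#-any (λ c x → (γ x ≟ c) ×-dec (length (colourClass c) ≤? τ)) (allFin n) per)
      where
      per : ∀ c → # (λ x → (γ x ≟ c) ×-dec (length (colourClass c) ≤? τ)) (allFin n) ≤ τ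
      per c with length (colourClass c) ≤? τ
      ... | yes ≤τ = ≤-trans (#-mono (λ x → (γ x ≟ c) ×-dec yes ≤τ) (λ x → γ x ≟ c) proj₁ (allFin n)) ≤τ
      ... | no  ≰τ = ≤-trans
        (≤-reflexive (#-none (λ x → (γ x ≟ c) ×-dec no ≰τ) (λ _ → ≰τ ∘ proj₂) (allFin n))) z≤n

    -- Otherwise every element would lie in a class of size at most `t`, and there are at most
    -- `l * t` such elements.
    large-class : ∀ t → l * t < n → ∃[ c ] t < length (colourClass c)
    large-class t lt<n with any? (λ c → t <? length (colourClass c))
    ... | yes found = found
    ... | no  none  = contradiction (≤-trans n≤ (#-light t)) (<⇒≱ lt<n)
      where
      n≤ : n ≤ # (λ x → length (colourClass (γ x)) ≤? t) (allFin n)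
      n≤ = ≤-reflexive (trans (sym (length-tabulate id)) (cong length (sym (filter-all _
             (ListAll.universal (λ x → ≮⇒≥ λ t< → none (γ x , t<)) (allFin n))))))

    member : ∀ {c N} → N ≤ length (colourClass c) → Fin N → Fin n
    member {c} N≤ x = List.lookup (colourClass c) (inject≤ x N≤)

    member-colour : ∀ {c N} (N≤ : N ≤ length (colourClass c)) x → γ (member N≤ x) ≡ c
    member-colour {c} N≤ x = ∈-colourClass⁻ (∈-lookup (inject≤ x N≤))

    member-injective : ∀ {c c′ N} (N≤ : N ≤ length (colourClass c))
                       (N≤′ : N ≤ length (colourClass c′)) {x y} →
                       member N≤ x ≡ member N≤′ y → c ≡ c′ × x ≡ y
    member-injective N≤ N≤′ {x} {y} eq
      with refl ← trans (sym (member-colour N≤ x)) (trans (cong γ eq) (member-colour N≤′ y))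
      = refl , inject≤-injective N≤ N≤′ x y (lookup-injective (colourClass-unique _) eq)

    module _ {s} (f : Fin s → Fin n) (g : Fin s → Fin l) where

      recolour : Colouring l n
      recolour y with any? (λ x → f x ≟ y)
      ... | yes (x , _) = g x
      ... | no  _       = γ y

      recolour-cases : ∀ y → (∃[ x ] f x ≡ y × recolour y ≡ g x) ⊎ (recolour y ≡ γ y)
      recolour-cases y with any? (λ x → f x ≟ y)
      ... | yes (x , eq) = inj₁ (x , eq , refl)
      ... | no  _        = inj₂ refl

      recolour-hit : Injective _≡_ _≡_ f → ∀ x → recolour (f x) ≡ g x
      recolour-hit inj x with any? (λ x′ → f x′ ≟ f x)
      ... | yes (x′ , eq) = cong g (inj eq)
      ... | no  miss      = contradiction (x , refl) miss

      recolour-miss : ∀ {y} → (∀ x → f x ≢ y) → recolour y ≡ γ y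
      recolour-miss {y} miss with any? (λ x → f x ≟ y)
      ... | yes (x , eq) = contradiction eq (miss x)
      ... | no  _        = refl

    module _ {s} (f : Fin s → Fin n) {i j : Fin l} (f-colour : ∀ x → γ (f x) ≡ j) where

      -- All moved elements come from class `j`, so of two differently coloured elements at most one
      -- is moved; it receives colour `i`, which the other one does not have.
      recolour-separates : ∀ {y z} → γ y ≢ i → γ z ≢ i → γ y ≢ γ z →
                           recolour f (const i) y ≢ recolour f (const i) z
      recolour-separates {y} {z} y≢i z≢i γy≢γz eq
        with recolour-cases f (const i) y | recolour-cases f (const i) z
      ... | inj₁ (x , refl , _) | inj₁ (x′ , refl , _) = γy≢γz (trans (f-colour x) (sym (f-colour x′)))
      ... | inj₁ (_ , _ , p)    | inj₂ q               = z≢i (trans (sym q) (trans (sym eq) p))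
      ... | inj₂ p              | inj₁ (_ , _ , q)     = y≢i (trans (sym p) (trans eq q))
      ... | inj₂ p              | inj₂ q               = γy≢γz (trans (sym p) (trans eq q))

  -- The two colour rules and three ways to improve a colouring

  module _ (l : ℕ) where

    nonMonochromatic : ColourRule l
    nonMonochromatic = record
      { good      = λ c → ∃[ i ] ∃[ j ] c i ≢ c j
      ; good?     = λ c → any? λ i → any? λ j → ¬? (c i ≟ c j)
      ; good-ext  = λ f≗g (i , j , ne) → i , j , λ eq → ne (trans (f≗g i) (trans eq (sym (f≗g j))))
      ; good-perm = λ {_} {c} π (i , j , ne) → π ⟨$⟩ˡ i , π ⟨$⟩ˡ j , λ eq →
          ne (trans (cong c (sym (inverseʳ π))) (trans eq (cong c (inverseʳ π))))
      }

    rainbow : ColourRule l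
    rainbow = record
      { good      = Distinct
      ; good?     = distinct?
      ; good-ext  = distinct-ext
      ; good-perm = λ π d i j i≢j → d _ _ λ eq →
          i≢j (trans (sym (inverseˡ π)) (trans (cong (π ⟨$⟩ˡ_) eq) (inverseˡ π)))
      }

  module Splitting {l n m s : ℕ} (γ : Colouring l n) where

    M : ℕ
    M = suc (suc m)

    module _ {i j : Fin l} (i≢j : i ≢ j) (big : M * s ≤ length (colourClass γ j)) where

      private
        e : Fin M → Fin s → Fin n
        e t x = member γ big (combine t x)

        e-colour : ∀ t x → γ (e t x) ≡ j
        e-colour t x = member-colour γ big (combine t x)

        e-injective : ∀ {t x t′ x′} → e t x ≡ e t′ x′ → t ≡ t′ × x ≡ x′
        e-injective {t} {x} {t′} {x′} = combine-injective t x t′ x′ ∘ proj₂ ∘ member-injective γ big big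

        γ′ : Colouring l n
        γ′ = recolour γ (e 0F) (const i)

        first-block : ∀ x → γ′ (e 0F x) ≡ i
        first-block = recolour-hit γ (e 0F) (const i)
          (λ {x} {y} eq → proj₂ (e-injective {0F} {x} {0F} {y} eq))

        other-block : ∀ t x → 0F ≢ t → γ′ (e t x) ≡ j
        other-block t x 0≢t = trans (recolour-miss γ (e 0F) (const i)
          (λ x′ eq → 0≢t (proj₁ (e-injective {0F} {x′} {t} {x} eq)))) (e-colour t x)

      -- All blocks lie in class `j`, so `γ` is constant on each transversal. Recolouring block 0
      -- alone creates a second colour, because there are at least two blocks.
      splitMonochromatic : Improvement (nonMonochromatic l) M s (length (colourClass γ i)) γ
      splitMonochromatic = record
        { γ′          = γ′
        ; B           = λ y → γ y ≡ i
        ; B?          = λ y → γ y ≟ i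
        ; cover       = colourClass γ i
        ; B⊆cover     = ∈-colourClass⁺ γ
        ; cover≤      = ≤-refl
        ; e           = e
        ; e-injective = e-injective
        ; kept        = λ (p , q , ne) ¬B → p , q , recolour-separates γ (e 0F) (e-colour 0F) (¬B p) (¬B q) ne
        ; gained      = λ u → 0F , 1F , λ eq →
            i≢j (trans (sym (first-block (u 0F))) (trans eq (other-block 1F (u 1F) λ ())))
        ; new         = λ u (p , q , ne) → contradiction (trans (e-colour p (u p)) (sym (e-colour q (u q)))) ne
        }

    module _ (M≤l : M ≤ l) (M*s≤n : M * s ≤ n) (τ : ℕ)
      (none : ¬ (∃[ a ] Distinct (γ ∘ a) × (∀ (t : Fin M) → ¬ length (colourClass γ (γ (a t))) ≤ τ))) where

      private
        e : Fin M → Fin s → Fin n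
        e t x = inject≤ (combine t x) M*s≤n

        light? : ∀ y → Dec (length (colourClass γ (γ y)) ≤ τ)
        light? y = length (colourClass γ (γ y)) ≤? τ

        blockOf : Fin (M * s) → Fin l
        blockOf z = inject≤ (proj₁ (remQuot {M} s z)) M≤l

        γ′ : Colouring l n
        γ′ = recolour γ (λ z → inject≤ z M*s≤n) blockOf

        γ′-block : ∀ t x → γ′ (e t x) ≡ inject≤ t M≤l
        γ′-block t x = trans (recolour-hit γ (λ z → inject≤ z M*s≤n) blockOf
            (λ {y} {z} → inject≤-injective _ _ y z) (combine t x))
                             (cong (λ (t , _) → inject≤ t M≤l) (remQuot-combine {M} t x))

      -- By `none`, every rainbow tuple of `γ` has a light entry. So nothing avoiding `B` has to be
      -- preserved and `new` holds for any blocks; `γ′` may simply give block `t` the colour `t`.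
      splitEvenly : Improvement (rainbow l) M s (l * τ) γ
      splitEvenly = record
        { γ′          = γ′
        ; B           = λ y → length (colourClass γ (γ y)) ≤ τ
        ; B?          = light?
        ; cover       = filter light? (allFin n)
        ; B⊆cover     = ∈-filter⁺ light? (∈-allFin _)
        ; cover≤      = #-light γ τ
        ; e           = e
        ; e-injective = λ {t} {x} {t′} {x′} → combine-injective t x t′ x′
                          ∘ inject≤-injective M*s≤n M*s≤n (combine t x) (combine t′ x′)
        ; kept        = λ {a} d ¬B → contradiction (a , d , ¬B) none
        ; gained      = λ u p q p≢q eq → p≢q (inject≤-injective _ _ _ _
                          (trans (sym (γ′-block p (u p))) (trans eq (γ′-block q (u q)))))
        ; new         = λ u d → decidable-stable (any? λ t → light? (e t (u t))) λ ¬B →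
                          none ((λ t → e t (u t)) , d , λ t b → ¬B (t , b))
        }

    module _ (c : Fin M → Fin l) (c-distinct : Distinct c) {i : Fin l} (i≢c : ∀ t → i ≢ c t)
             (big : ∀ t → 2 * s ≤ length (colourClass γ (c t))) where

      private
        -- The blocks 0 and 1 are the two halves of (part of) class c 0.
        donor : Fin M → Fin M
        donor 0F                    = 0F
        donor 1F                    = 0F
        donor (Fin.suc (Fin.suc t)) = Fin.suc (Fin.suc t)

        half : Fin M → Fin 2
        half 0F                    = 0F
        half 1F                    = 1F
        half (Fin.suc (Fin.suc t)) = 0F

        donor×half-injective : ∀ t t′ → donor t ≡ donor t′ → half t ≡ half t′ → t ≡ t′
        donor×half-injective 0F 0F _ _ = refl
        donor×half-injective 1F 1F _ _ = refl
        donor×half-injective (Fin.suc (Fin.suc t)) (Fin.suc (Fin.suc t′)) eq _ = eq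
        donor×half-injective 0F 1F _ ()

        c-injective : ∀ {t t′} → c t ≡ c t′ → t ≡ t′
        c-injective {t} {t′} eq = decidable-stable (t ≟ t′) λ t≢t′ → c-distinct t t′ t≢t′ eq

        e : Fin M → Fin s → Fin n
        e t x = member γ (big (donor t)) (combine (half t) x)

        e-colour : ∀ t x → γ (e t x) ≡ c (donor t)
        e-colour t x = member-colour γ (big (donor t)) (combine (half t) x)

        e-injective : ∀ {t x t′ x′} → e t x ≡ e t′ x′ → t ≡ t′ × x ≡ x′
        e-injective {t} {x} {t′} {x′} eq =
          let c≡ , z≡ = member-injective γ (big (donor t)) (big (donor t′)) eq
              h≡ , x≡ = combine-injective (half t) x (half t′) x′ z≡
          in donor×half-injective t t′ (c-injective c≡) h≡ , x≡

        γ′ : Colouring l n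
        γ′ = recolour γ (e 0F) (const i)

        γ′-zero : ∀ x → γ′ (e 0F x) ≡ i
        γ′-zero = recolour-hit γ (e 0F) (const i) (λ {x} {y} eq → proj₂ (e-injective {0F} {x} {0F} {y} eq))

        γ′-suc : ∀ t x → γ′ (e (Fin.suc t) x) ≡ c (donor (Fin.suc t))
        γ′-suc t x = trans (recolour-miss γ (e 0F) (const i) λ x′ eq →
          contradiction (proj₁ (e-injective {0F} {x′} {Fin.suc t} {x} eq)) λ ()) (e-colour (Fin.suc t) x)

        donor-suc-injective : ∀ p q → donor (Fin.suc p) ≡ donor (Fin.suc q) → p ≡ q
        donor-suc-injective 0F          0F          _  = refl
        donor-suc-injective (Fin.suc p) (Fin.suc q) eq = suc-injective eq

        gained : ∀ (u : Fin M → Fin s) → Distinct (λ t → γ′ (e t (u t)))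
        gained u 0F          0F          p≢q eq = p≢q refl
        gained u 0F          (Fin.suc q) p≢q eq = i≢c _ (trans (sym (γ′-zero _)) (trans eq (γ′-suc q _)))
        gained u (Fin.suc p) 0F          p≢q eq = i≢c _ (trans (sym (γ′-zero _)) (trans (sym eq) (γ′-suc p _)))
        gained u (Fin.suc p) (Fin.suc q) p≢q eq = p≢q (cong Fin.suc (donor-suc-injective p q (c-injective
          (trans (sym (γ′-suc p _)) (trans eq (γ′-suc q _))))))

      -- On a transversal `γ` repeats the colour `c 0F` in blocks 0 and 1. Under `γ′` block 0 has
      -- colour `i`, which differs from all colours of `c`, and the repetition disappears.
      splitHeavyClass : Improvement (rainbow l) M s (length (colourClass γ i)) γ
      splitHeavyClass = record
        { γ′          = γ′
        ; B           = λ y → γ y ≡ i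
        ; B?          = λ y → γ y ≟ i
        ; cover       = colourClass γ i
        ; B⊆cover     = ∈-colourClass⁺ γ
        ; cover≤      = ≤-refl
        ; e           = e
        ; e-injective = e-injective
        ; kept        = λ d ¬B p q p≢q → recolour-separates γ (e 0F) (e-colour 0F) (¬B p) (¬B q) (d p q p≢q)
        ; gained      = gained
        ; new         = λ u d → contradiction (trans (e-colour 0F (u 0F)) (sym (e-colour 1F (u 1F))))
                                        (d 0F 1F λ ())
        }

  -- Arithmetic of the exponents

  quotient-bounds : ∀ n d .{{_ : NonZero d}} → d ≤ n →
                    ∃[ s ] 1 ≤ s × s * d ≤ n × n < suc s * d × n ≤ 2 * d * s
  -- The remainder is below `d`, hence below `s * d` or equal to it at most, since `1 ≤ s`; this
  -- gives the factor 2.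
  quotient-bounds n d d≤n = s , 1≤s , m/n*n≤m n d , n< , ≤-trans (<⇒≤ n<) (begin
      d + s * d      ≤⟨ +-monoˡ-≤ (s * d) (m≤n*m d s {{>-nonZero 1≤s}}) ⟩
      s * d + s * d  ≡⟨ rearrange s d ⟩
      2 * d * s      ∎)
    where
    open ≤-Reasoning
    s = n / d
    1≤s : 1 ≤ s
    1≤s = ≤-trans (≤-reflexive (sym (n/n≡1 d))) (/-mono-≤ d≤n (≤-refl {d}))
    n< : n < suc s * d
    n< = begin-strict
      n              ≡⟨ m≡m%n+[m/n]*n n d ⟩
      n % d + s * d  <⟨ +-monoˡ-< (s * d) (m%n<n n d) ⟩
      suc s * d      ∎
    rearrange : ∀ s d → s * d + s * d ≡ 2 * d * s
    rearrange = solve-∀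

  *-^ : ∀ a b m → (a * b) ^ m ≡ a ^ m * b ^ m
  *-^ a b zero    = refl
  *-^ a b (suc m) = trans (cong (a * b *_) (*-^ a b m)) ([m*n]*[o*p]≡[m*o]*[n*p] a b (a ^ m) (b ^ m))

  power-bound : ∀ {n c s} M → n ≤ c * s → n ^ M ≤ c ^ M * s ^ M
  power-bound {c = c} {s} M n≤ = ≤-trans (^-monoˡ-≤ M n≤) (≤-reflexive (*-^ c s M))

  m≤m^[1+n] : ∀ m n → m ≤ m ^ suc n
  m≤m^[1+n] zero    n = z≤n
  m≤m^[1+n] (suc m) n = m≤m*n (suc m) (suc m ^ n) {{m^n≢0 (suc m) n}}

  module _ {l} (C : ColourRule l) (ρ M q : ℕ) where

    -- The constant `c` may differ from one colouring to another, while the final exponent needs a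
    -- common `q`. `few-lost` keeps the lost tuples of all `ρ` symbols below a quarter of the new
    -- ones.
    record Improvable {n} (γ : Colouring l n) : Set₁ where
      field
        {s b c}     : ℕ
        improvement : Improvement C M s b γ
        many-new    : n ^ M ≤ c * s ^ M
        few-lost    : b * (4 * c * ρ * M) ≤ n
        4c≤q        : 4 * c ≤ q

  -- After multiplication by `4 * c`, the left side splits into the lost tuples, the desired
  -- exponent and the terms of lower order. Each part is at most `n ^ suc (suc m)`, and the right
  -- side is at least four times that.
  exponent-room : ∀ {l ρ m n s b c q} .{{_ : NonZero q}} .{{_ : NonZero n}} →
    n ^ suc (suc m) ≤ c * s ^ suc (suc m) → b * (4 * c * ρ * suc (suc m)) ≤ n → 4 * c ≤ q →
    q * (ρ + l + 1) ≤ n →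
    ρ * (suc (suc m) * (b * n ^ suc m) + n ^ suc m) + (suc (n ^ suc (suc m) / q) + l * n) ≤ s ^ suc (suc m)
  -- With `c = 0` the power of `n` would vanish; afterwards `4 * c` can be cancelled.
  exponent-room {m = m} {n} {c = zero} many few c≤ n≥ = contradiction many (<⇒≱ (m^n>0 n (suc (suc m))))
  exponent-room {l} {ρ} {m} {n} {s} {b} {c@(suc _)} {q} many few c≤ n≥ = *-cancelˡ-≤ (4 * c) (begin
    4 * c * (ρ * (M * (b * w) + w) + (E + l * n))
      ≡⟨ expand c ρ M b w E l n ⟩
    b * (4 * c * ρ * M) * w + 4 * c * (ρ * w + E + l * n)
      ≤⟨ +-mono-≤ (*-monoˡ-≤ w few) (*-monoˡ-≤ (ρ * w + E + l * n) c≤) ⟩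
    n * w + q * (ρ * w + E + l * n)
      ≡⟨ split n w q ρ (n * w / q) l ⟩
    n * w + n * w / q * q + q * (ρ * w + 1 + l * n)
      ≤⟨ +-mono-≤ (+-monoʳ-≤ (n * w) (m/n*n≤m (n * w) q))
           (*-monoʳ-≤ q (+-mono-≤ (+-monoʳ-≤ (ρ * w) (m^n>0 n (suc m))) (*-monoʳ-≤ l (m≤m^[1+n] n m)))) ⟩
    n * w + n * w + q * (ρ * w + w + l * w)
      ≡⟨ cong (n * w + n * w +_) (collect q ρ w l) ⟩
    n * w + n * w + q * (ρ + l + 1) * w
      ≤⟨ +-monoʳ-≤ (n * w + n * w) (*-monoˡ-≤ w n≥) ⟩
    n * w + n * w + n * w
      ≤⟨ m≤m+n _ (n * w) ⟩
    n * w + n * w + n * w + n * w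
      ≡⟨ four (n * w) ⟩
    4 * (n * w)
      ≤⟨ *-monoʳ-≤ 4 many ⟩
    4 * (c * s ^ M)
      ≡⟨ *-assoc 4 c (s ^ M) ⟨
    4 * c * s ^ M ∎)
    where
    open ≤-Reasoning
    M = suc (suc m)
    w = n ^ suc m
    E = suc (n * w / q)
    expand : ∀ c ρ M b w E l n → 4 * c * (ρ * (M * (b * w) + w) + (E + l * n)) ≡
                                 b * (4 * c * ρ * M) * w + 4 * c * (ρ * w + E + l * n)
    expand = solve-∀
    split : ∀ n w q ρ d l → n * w + q * (ρ * w + suc d + l * n) ≡ n * w + d * q + q * (ρ * w + 1 + l * n)
    split = solve-∀
    collect : ∀ q ρ w l → q * (ρ * w + w + l * w) ≡ q * (ρ + l + 1) * w
    collect = solve-∀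
    four : ∀ x → x + x + x + x ≡ 4 * x
    four = solve-∀

  n≤d*[1+n/d] : ∀ n d .{{_ : NonZero d}} → n ≤ d * suc (n / d)
  n≤d*[1+n/d] n d = begin
    n                    ≡⟨ m≡m%n+[m/n]*n n d ⟩
    n % d + n / d * d    ≤⟨ +-monoˡ-≤ _ (<⇒≤ (m%n<n n d)) ⟩
    suc (n / d) * d      ≡⟨ *-comm (suc (n / d)) d ⟩
    d * suc (n / d)      ∎
    where open ≤-Reasoning

  module _ {l} (C : ColourRule l) (L : Vocabulary) (I : Subset (ρ L))
           {n m q : ℕ} .{{_ : NonZero q}} .{{_ : NonZero n}}
           (small : ∀ k → arity L k ≤ suc m ⊎ arity L k ≡ suc (suc m) ⊎
                          (∀ (c : Fin (arity L k) → Fin l) → ¬ ColourRule.good C c))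
           (k : Fin (ρ L)) (k≡ : arity L k ≡ suc (suc m))
           (n≥ : q * (ρ L + l + 1) ≤ n)
           {Bad : Pred (Colouring l n) 0ℓ} (Bad? : Decidable Bad) (Bad-ext : Extensional Bad)
           (improvable : ∀ γ → Bad γ → Improvable C (ρ L) (suc (suc m)) q γ)
           {K X : Pred (Structure L n) 0ℓ} (K? : Decidable K) (X? : Decidable X)
           (K⊇ : ∀ {M} {γ} → Fits C L I γ M → K M)
           (X⊆ : ∀ {M} → X M → ∃[ γ ] Bad γ × Fits C L I γ M) where

    improvable⇒rare : # X? (structures L n) * 2 ^ suc (n ^ suc (suc m) / q) ≤ # K? (structures L n)
    improvable⇒rare = bad-colourings-rare C L I Bad? Bad-ext K? X? X⊆ E rare
      where
      open ≤-Reasoning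
      E = suc (n ^ suc (suc m) / q)
      rare : ∀ γ → Bad γ → # (fits? C L I γ) (structures L n) * 2 ^ (E + l * n) ≤ # K? (structures L n)
      rare γ bad = *-cancelʳ-≤ _ _ (2 ^ lost) {{m^n≢0 2 lost}} (begin
        f * 2 ^ (E + l * n) * 2 ^ lost       ≡⟨ *-assoc f _ _ ⟩
        f * (2 ^ (E + l * n) * 2 ^ lost)     ≡⟨ cong (f *_) (trans (*-comm _ (2 ^ lost))
                                                                (sym (^-distribˡ-+-* 2 lost (E + l * n)))) ⟩
        f * 2 ^ (lost + (E + l * n))         ≤⟨ *-monoʳ-≤ f (^-monoʳ-≤ 2 (
                                                  exponent-room {l} {ρ L} {m} {n} {s} {b} {c} many-new few-lost 4c≤q n≥)) ⟩
        f * 2 ^ (s ^ suc (suc m))            ≤⟨ structures-gain C L I improvement small k k≡ ⟩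
        # (fits? C L I γ′) (structures L n) * 2 ^ lost
                                             ≤⟨ *-monoˡ-≤ (2 ^ lost) (#-mono (fits? C L I γ′) K? (K⊇ {γ = γ′}) (structures L n)) ⟩
        # K? (structures L n) * 2 ^ lost     ∎)
        where
        open Improvable (improvable γ bad)
        open Improvement improvement using (γ′)
        f = # (fits? C L I γ) (structures L n)
        lost = ρ L * slack C L I improvement

  -- Every colouring with a small class can be improved

  module Scale (l m ρ : ℕ) .{{_ : NonZero l}} .{{_ : NonZero ρ}} where

    M : ℕ
    M = suc (suc m)

    -- The factor in `few-lost` when the blocks have at least `n / c` elements: at most
    -- `n / scale c` elements may then be sacrificed.
    scale : ℕ → ℕ
    scale c = 4 * c ^ M * ρ * M

    c≤scale : ∀ c → c ≤ scale c
    c≤scale c = begin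
      c                     ≤⟨ m≤m^[1+n] c (suc m) ⟩
      c ^ M                 ≤⟨ m≤n*m (c ^ M) 4 ⟩
      4 * c ^ M             ≤⟨ m≤m*n (4 * c ^ M) ρ ⟩
      4 * c ^ M * ρ         ≤⟨ m≤m*n _ M ⟩
      scale c               ∎
      where open ≤-Reasoning

  module NonMonochromatic (l m ρ : ℕ) .{{_ : NonZero l}} .{{_ : NonZero ρ}} where

    open Scale l m ρ public

    -- Some class has about `n / l` elements and is cut into `M` blocks; the 2 compensates for
    -- rounding.
    c₀ : ℕ
    c₀ = 2 * (l * M)

    improvable : ∀ {n} → l * M ≤ n → ∀ (γ : Colouring l n) i → length (colourClass γ i) * scale c₀ < n →
                 Improvable (nonMonochromatic l) ρ M (4 * c₀ ^ M) γ
    improvable {n} lM≤n γ i i-small with quotient-bounds n (l * M) {{m*n≢0 l M}} lM≤n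
    -- `large-class` yields a strict inequality, so it is applied to the predecessor of `M * s`.
    ... | s@(suc s-1) , _ , s*lM≤n , _ , n≤cs with large-class γ (s-1 + suc m * s) (begin-strict
            l * (s-1 + suc m * s)  <⟨ *-monoʳ-< l (n<1+n _) ⟩
            l * (M * s)            ≡⟨ trans (sym (*-assoc l M s)) (*-comm (l * M) s) ⟩
            s * (l * M)            ≤⟨ s*lM≤n ⟩
            n                      ∎)
      where open ≤-Reasoning
    ...   | j , Ms≤j = record
      { s = s ; b = length (colourClass γ i) ; c = c₀ ^ M
      ; improvement = Splitting.splitMonochromatic {m = m} {s = s} γ i≢j Ms≤j
      ; many-new    = power-bound {c = c₀} {s} M n≤cs
      ; few-lost    = <⇒≤ i-small
      ; 4c≤q        = ≤-refl
      }
      where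
      open ≤-Reasoning
      i≢j : i ≢ j
      i≢j refl = <⇒≱ i-small (begin
        n                                      ≤⟨ n≤cs ⟩
        c₀ * s                                 ≡⟨ *-comm c₀ s ⟩
        s * c₀                                 ≤⟨ *-mono-≤ (m≤n*m s M) (c≤scale c₀) ⟩
        M * s * scale c₀                       ≤⟨ *-monoˡ-≤ (scale c₀) Ms≤j ⟩
        length (colourClass γ i) * scale c₀    ∎)

  -- A class is light if it has at most n / d elements.  A rainbow tuple with no
  -- light colour supplies a class to split; if there is none, γ is compared with
  -- an even colouring instead.
  module Rainbow (l m ρ : ℕ) .{{_ : NonZero l}} .{{_ : NonZero ρ}} (M≤l : suc (suc m) ≤ l) where

    open Scale l m ρ public

    -- The light classes contain at most `l * (n / d)` elements together, and `d` makes this few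
    -- enough for even blocks of size at least `n / (2 * l)`. In `c₀`, the factor `2 * d` comes from
    -- the size of a heavy class and `2 * 2` from halving it, both with rounding.
    d c₀ : ℕ
    d  = l * scale (2 * l)
    c₀ = 2 * d * (2 * 2)

    l≤d : l ≤ d
    l≤d = ≤-trans (m≤n*m l 2) (≤-trans (c≤scale (2 * l)) (m≤n*m _ l))

    module _ {n} (2d≤n : 2 * d ≤ n) (γ : Colouring l n) (i : Fin l)
             (i-small : length (colourClass γ i) * scale c₀ < n) where

      private
        d≤n : d ≤ n
        d≤n = ≤-trans (m≤n*m d 2) 2d≤n

        Heavy : ℕ → Pred (Tuple M n) 0ℓ
        Heavy τ a = Distinct (γ ∘ a) × (∀ t → ¬ length (colourClass γ (γ (a t))) ≤ τ)

        heavy? : ∀ τ → Dec (∃ (Heavy τ))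
        heavy? τ = ∃fun?
          (λ f≗g (dist , heavy) → distinct-ext (cong γ ∘ f≗g) dist ,
            λ t → subst (λ y → ¬ length (colourClass γ (γ y)) ≤ τ) (f≗g t) (heavy t))
          (λ a → distinct? (γ ∘ a) ×-dec all? (λ t → ¬? (length (colourClass γ (γ (a t))) ≤? τ)))

        withoutHeavy : ∀ {s τ} → s * l ≤ n → n ≤ 2 * l * s → τ * d ≤ n → ¬ (∃ (Heavy τ)) →
                       Improvable (rainbow l) ρ M (4 * c₀ ^ M) γ
        withoutHeavy {s} {τ} s*l≤n n≤2ls τ*d≤n none = record
          { s = s ; b = l * τ ; c = (2 * l) ^ M
          ; improvement = Splitting.splitEvenly {m = m} {s = s} γ M≤l
              (≤-trans (*-monoˡ-≤ s M≤l) (≤-trans (≤-reflexive (*-comm l s)) s*l≤n)) τ none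
          ; many-new    = power-bound {c = 2 * l} {s} M n≤2ls
          ; few-lost    = ≤-trans (≤-reflexive (trans (cong (_* scale (2 * l)) (*-comm l τ))
                                                      (*-assoc τ l (scale (2 * l))))) τ*d≤n
          ; 4c≤q        = *-monoʳ-≤ 4 (^-monoˡ-≤ M (≤-trans (*-monoʳ-≤ 2 l≤d) (m≤m*n (2 * d) 4)))
          }

        withHeavy : ∀ {s τ} → s * 2 ≤ τ → n < suc τ * d → n ≤ 2 * d * τ → τ ≤ 2 * 2 * s → ∃ (Heavy τ) →
                    Improvable (rainbow l) ρ M (4 * c₀ ^ M) γ
        withHeavy {s} {τ} s*2≤τ n<[1+τ]d n≤2dτ τ≤4s (a , dist , heavy) = record
          { s = s ; b = length (colourClass γ i) ; c = c₀ ^ M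
          ; improvement = Splitting.splitHeavyClass {m = m} {s = s} γ (γ ∘ a) dist i≢ (λ t →
              ≤-trans (≤-reflexive (*-comm 2 s)) (≤-trans s*2≤τ (<⇒≤ (≰⇒> (heavy t)))))
          ; many-new    = power-bound {c = c₀} {s} M (begin
              n                  ≤⟨ n≤2dτ ⟩
              2 * d * τ          ≤⟨ *-monoʳ-≤ (2 * d) τ≤4s ⟩
              2 * d * (2 * 2 * s) ≡⟨ *-assoc (2 * d) (2 * 2) s ⟨
              c₀ * s             ∎)
          ; few-lost    = <⇒≤ i-small
          ; 4c≤q        = ≤-refl
          }
          where
          open ≤-Reasoning
          d≤scale : d ≤ scale c₀
          d≤scale = ≤-trans (m≤n*m d 2) (≤-trans (m≤m*n (2 * d) 4) (c≤scale c₀))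
          -- A heavy class has more than `n / d` elements, class `i` has fewer than `n / scale c₀`,
          -- and `d ≤ scale c₀`.
          i≢ : ∀ t → i ≢ γ (a t)
          i≢ t i≡ = <⇒≱ i-small (begin
            n                                          ≤⟨ <⇒≤ n<[1+τ]d ⟩
            suc τ * d                                  ≤⟨ *-mono-≤ (≰⇒> (heavy t)) d≤scale ⟩
            length (colourClass γ (γ (a t))) * scale c₀
                                                       ≡⟨ cong (λ c → length (colourClass γ c) * scale c₀) i≡ ⟨
            length (colourClass γ i) * scale c₀        ∎)

      improvable : Improvable (rainbow l) ρ M (4 * c₀ ^ M) γ
      improvable =
        let s , _ , s*l≤n , _ , n≤2ls             = quotient-bounds n l (≤-trans l≤d d≤n)
            τ , _ , τ*d≤n , n<[1+τ]d , n≤2dτ      = quotient-bounds n d d≤n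
            -- Here `2 * d ≤ n` enters: with `2 ≤ τ` half of a heavy class still provides a block of
            -- at least `τ / 4` elements.
            2≤τ = s≤s⁻¹ (*-cancelʳ-< d 2 (suc τ) (≤-<-trans 2d≤n n<[1+τ]d))
            s′ , _ , s′*2≤τ , _ , τ≤4s′           = quotient-bounds τ 2 2≤τ
        in fromDec {s} {τ} {s′} s*l≤n n≤2ls τ*d≤n n<[1+τ]d n≤2dτ s′*2≤τ τ≤4s′ (heavy? τ)
        where
        instance
          d≢0 : NonZero d
          d≢0 = >-nonZero (≤-trans (>-nonZero⁻¹ l) l≤d)
        fromDec : ∀ {s τ s′} → s * l ≤ n → n ≤ 2 * l * s → τ * d ≤ n → n < suc τ * d → n ≤ 2 * d * τ →
                  s′ * 2 ≤ τ → τ ≤ 2 * 2 * s′ → Dec (∃ (Heavy τ)) → Improvable (rainbow l) ρ M (4 * c₀ ^ M) γ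
        fromDec s*l≤n n≤2ls τ*d≤n _ _ _ _ (no none) = withoutHeavy s*l≤n n≤2ls τ*d≤n none
        fromDec {s′ = s′} _ _ _ n<[1+τ]d n≤2dτ s′*2≤τ τ≤4s′ (yes a) =
          withHeavy {s′} s′*2≤τ n<[1+τ]d n≤2dτ τ≤4s′ a

-- Rational estimates

open Combinatorics
open import Algebra.Bundles using (CommutativeMonoid)
open import Algebra.Definitions.RawSemiring using () renaming (_^_ to pow)
open import Data.Integer as ℤ using (+_; +[1+_]; +0; -[1+_])
import Data.Integer.Properties as ℤ
open import Data.List.Extrema.Nat using (max; xs≤max; argmax-sel)
open import Data.Nat as ℕ using (ℕ; zero; suc; pred; NonTrivial; NonZero; nonTrivial⇒nonZero; _^_)
  renaming (_+_ to _+ℕ_; _*_ to _*ℕ_; _≤_ to _≤ℕ_; _<_ to _<ℕ_)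
open import Data.Nat.Coprimality using (1-coprimeTo)
import Data.Nat.DivMod as ℕ
import Data.Nat.Properties as ℕ
open import Data.Rational
  using (ℚ; mkℚ; 0ℚ; 1ℚ; _<_; _≤_; _*_; _+_; _-_; -_; _/_; ∣_∣; ↧ₙ_; toℚᵘ; NonNegative; positive)
open import Data.Rational.Base using (+-*-rawSemiring)
import Data.Rational.Properties as ℚ
open import Data.Rational.Unnormalised as ℚᵘ using (mkℚᵘ; *≤*; *≡*)
import Data.Rational.Unnormalised.Properties as ℚᵘ
open import Data.Vec.Membership.Propositional.Properties using (∈-toList⁺; ∈-toList⁻) renaming (∈-lookup to ∈ᵥ-lookup)
import Data.Vec.Relation.Unary.Any as VecAny
import Data.Vec.Relation.Unary.Any.Properties as VecAny

-- In this explicit normal form the numerator and the denominator compute, as `_≤2^-[_·_]` requires.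
unitFraction : ℕ → ℚ
unitFraction d-1 = mkℚ (+ 1) d-1 (1-coprimeTo (suc d-1))

0<unitFraction : ∀ d-1 → 0ℚ < unitFraction d-1
0<unitFraction d-1 = ℚ.positive⁻¹ (unitFraction d-1)

toℚᵘ-/ : ∀ x y → toℚᵘ (+ x / suc y) ℚᵘ.≃ mkℚᵘ (+ x) y
toℚᵘ-/ x y = ℚ.toℚᵘ-fromℚᵘ (mkℚᵘ (+ x) y)

fraction-*≤1 : ∀ {x a y} .{{_ : NonZero y}} → x *ℕ a ≤ℕ y → (+ x / y) * (+ a / 1) ≤ 1ℚ
fraction-*≤1 {y = zero} {{()}}
fraction-*≤1 {x} {a} {suc y} xa≤y = ℚ.toℚᵘ-cancel-≤ (begin
  toℚᵘ ((+ x / suc y) * (+ a / 1))            ≃⟨ ℚ.toℚᵘ-homo-* (+ x / suc y) (+ a / 1) ⟩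
  toℚᵘ (+ x / suc y) ℚᵘ.* toℚᵘ (+ a / 1)      ≃⟨ ℚᵘ.*-cong (toℚᵘ-/ x y) (toℚᵘ-/ a 0) ⟩
  mkℚᵘ (+ x) y ℚᵘ.* mkℚᵘ (+ a) 0              ≤⟨ *≤* (subst₂ ℤ._≤_
      (trans (ℤ.pos-* x a) (sym (ℤ.*-identityʳ (+ x ℤ.* + a)))) (sym (ℤ.*-identityˡ _))
      (ℤ.+≤+ (ℕ.≤-trans xa≤y (ℕ.≤-reflexive (sym (ℕ.*-identityʳ (suc y))))))) ⟩
  mkℚᵘ (+ 1) 0                                ∎)
  where open ℚᵘ.≤-Reasoning

unitFraction-*≤ : ∀ {n k} d-1 → n ≤ℕ k *ℕ suc d-1 → unitFraction d-1 * (+ n / 1) ≤ + k / 1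
unitFraction-*≤ {n} {k} d-1 n≤ = ℚ.toℚᵘ-cancel-≤ (begin
  toℚᵘ (unitFraction d-1 * (+ n / 1))         ≃⟨ ℚ.toℚᵘ-homo-* (unitFraction d-1) (+ n / 1) ⟩
  mkℚᵘ (+ 1) d-1 ℚᵘ.* toℚᵘ (+ n / 1)          ≃⟨ ℚᵘ.*-congˡ {mkℚᵘ (+ 1) d-1} (toℚᵘ-/ n 0) ⟩
  mkℚᵘ (+ 1) d-1 ℚᵘ.* mkℚᵘ (+ n) 0            ≤⟨ *≤* (subst₂ ℤ._≤_
      (sym (trans (ℤ.*-identityʳ _) (ℤ.*-identityˡ (+ n))))
      (ℤ.pos-* k _)
      (ℤ.+≤+ (ℕ.≤-trans n≤ (ℕ.≤-reflexive (cong (k *ℕ_) (sym (ℕ.*-identityʳ (suc d-1)))))))) ⟩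
  mkℚᵘ (+ k) 0                                ≃⟨ toℚᵘ-/ k 0 ⟨
  toℚᵘ (+ k / 1)                              ∎)
  where open ℚᵘ.≤-Reasoning

fromℕ-* : ∀ a b → + (a *ℕ b) / 1 ≡ (+ a / 1) * (+ b / 1)
fromℕ-* a b = ℚ.toℚᵘ-injective (begin
  toℚᵘ (+ (a *ℕ b) / 1)                ≈⟨ toℚᵘ-/ (a *ℕ b) 0 ⟩
  mkℚᵘ (+ (a *ℕ b)) 0                  ≈⟨ *≡* (cong (ℤ._* + 1) (ℤ.pos-* a b)) ⟩
  mkℚᵘ (+ a) 0 ℚᵘ.* mkℚᵘ (+ b) 0       ≈⟨ ℚᵘ.*-cong (toℚᵘ-/ a 0) (toℚᵘ-/ b 0) ⟨
  toℚᵘ (+ a / 1) ℚᵘ.* toℚᵘ (+ b / 1)   ≈⟨ ℚ.toℚᵘ-homo-* (+ a / 1) (+ b / 1) ⟨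
  toℚᵘ ((+ a / 1) * (+ b / 1))         ∎)
  where open ℚᵘ.≃-Reasoning

fromℕ-mono-≤ : ∀ {a b} → a ≤ℕ b → + a / 1 ≤ + b / 1
fromℕ-mono-≤ {a} {b} a≤b = ℚ.toℚᵘ-cancel-≤ (begin
  toℚᵘ (+ a / 1)   ≃⟨ toℚᵘ-/ a 0 ⟩
  mkℚᵘ (+ a) 0     ≤⟨ *≤* (ℤ.*-monoʳ-≤-nonNeg (+ 1) (ℤ.+≤+ a≤b)) ⟩
  mkℚᵘ (+ b) 0     ≃⟨ toℚᵘ-/ b 0 ⟨
  toℚᵘ (+ b / 1)   ∎)
  where open ℚᵘ.≤-Reasoning

infixr 8 _^ℚ_
_^ℚ_ : ℚ → ℕ → ℚ
_^ℚ_ = pow +-*-rawSemiring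

^ℚ-nonNegative : ∀ x .{{_ : NonNegative x}} q → NonNegative (x ^ℚ q)
^ℚ-nonNegative x zero    = _
^ℚ-nonNegative x (suc q) = ℚ.nonNeg*nonNeg⇒nonNeg x (x ^ℚ q) {{^ℚ-nonNegative x q}}

^ℚ-*≤1 : ∀ x .{{_ : NonNegative x}} a → x * (+ a / 1) ≤ 1ℚ → ∀ q → x ^ℚ q * (+ (a ^ q) / 1) ≤ 1ℚ
^ℚ-*≤1 x a xa≤1 zero    = ℚ.≤-refl
^ℚ-*≤1 x a xa≤1 (suc q) = begin
  x * x ^ℚ q * (+ (a *ℕ a ^ q) / 1)           ≡⟨ cong (x * x ^ℚ q *_) (fromℕ-* a (a ^ q)) ⟩
  x * x ^ℚ q * ((+ a / 1) * (+ (a ^ q) / 1))  ≡⟨ interchange x (x ^ℚ q) (+ a / 1) (+ (a ^ q) / 1) ⟩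
  x * (+ a / 1) * (x ^ℚ q * (+ (a ^ q) / 1))  ≤⟨ ℚ.*-monoˡ-≤-nonNeg (x * (+ a / 1)) (^ℚ-*≤1 x a xa≤1 q) ⟩
  x * (+ a / 1) * 1ℚ                          ≡⟨ ℚ.*-identityʳ _ ⟩
  x * (+ a / 1)                               ≤⟨ xa≤1 ⟩
  1ℚ                                          ∎
  where
  open ℚ.≤-Reasoning
  instance
    xa≥0 : NonNegative (x * (+ a / 1))
    xa≥0 = ℚ.nonNeg*nonNeg⇒nonNeg x (+ a / 1) {{ℚ.normalize-nonNeg a 1}}
  open import Algebra.Properties.CommutativeSemigroup (CommutativeMonoid.commutativeSemigroup ℚ.*-1-commutativeMonoid) using (interchange)

-- The fraction is at most `2 ^ (- E)`, and raising this to the power `q` gives an exponent of at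
-- least `t`.
fraction≤2^- : ∀ {x y E t} .{{_ : NonZero y}} q-1 → x *ℕ 2 ^ E ≤ℕ y → t ≤ℕ suc q-1 *ℕ E →
               (+ x / y) ≤2^-[ unitFraction q-1 · t ]
fraction≤2^- {x} {y} {E} {t} q-1 x2^E≤y t≤qE = begin
  p ^ℚ q * (+ (2 ^ (1 *ℕ t)) / 1)   ≤⟨ ℚ.*-monoˡ-≤-nonNeg (p ^ℚ q) {{^ℚ-nonNegative p q}} (fromℕ-mono-≤ power≤) ⟩
  p ^ℚ q * (+ ((2 ^ E) ^ q) / 1)    ≤⟨ ^ℚ-*≤1 p (2 ^ E) (fraction-*≤1 {x} {2 ^ E} {y} x2^E≤y) q ⟩
  1ℚ                                ∎
  where
  open ℚ.≤-Reasoning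
  q = suc q-1
  p = + x / y
  instance
    p≥0 : NonNegative p
    p≥0 = ℚ.normalize-nonNeg x y
  power≤ : 2 ^ (1 *ℕ t) ≤ℕ (2 ^ E) ^ q
  power≤ = ℕ.≤-trans
    (ℕ.^-monoʳ-≤ 2 (ℕ.≤-trans (ℕ.≤-reflexive (ℕ.*-identityˡ t))
      (ℕ.≤-trans t≤qE (ℕ.≤-reflexive (ℕ.*-comm q E)))))
    (ℕ.≤-reflexive (sym (ℕ.^-*-assoc 2 E q)))

complementary-fractions : ∀ {x z y} .{{_ : NonZero y}} → x +ℕ z ≡ y → (+ z / y) - 1ℚ ≡ - (+ x / y)
complementary-fractions {y = zero} {{()}}
complementary-fractions {x} {z} {suc y} x+z≡ = begin
  z/y - 1ℚ                  ≡⟨ cong (λ w → z/y - w) (sym sum) ⟩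
  z/y - (z/y + x/y)         ≡⟨ cong (λ w → z/y + w) (ℚ.neg-distrib-+ z/y x/y) ⟩
  z/y + (- z/y + - x/y)     ≡⟨ ℚ.+-assoc z/y (- z/y) (- x/y) ⟨
  z/y - z/y + - x/y         ≡⟨ cong (_+ - x/y) (ℚ.+-inverseʳ z/y) ⟩
  0ℚ + - x/y                ≡⟨ ℚ.+-identityˡ (- x/y) ⟩
  - x/y                     ∎
  where
  open ≡-Reasoning
  x/y = + x / suc y
  z/y = + z / suc y
  sum : z/y + x/y ≡ 1ℚ
  sum = ℚ.toℚᵘ-injective (ℚᵘ.≃-trans (ℚ.toℚᵘ-homo-+ z/y x/y) (ℚᵘ.≃-trans
    (ℚᵘ.+-cong (toℚᵘ-/ z y) (toℚᵘ-/ x y)) (*≡* (begin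
      (+ z ℤ.* Y ℤ.+ + x ℤ.* Y) ℤ.* + 1   ≡⟨ ℤ.*-identityʳ _ ⟩
      + z ℤ.* Y ℤ.+ + x ℤ.* Y             ≡⟨ ℤ.*-distribʳ-+ Y (+ z) (+ x) ⟨
      (+ z ℤ.+ + x) ℤ.* Y                 ≡⟨ cong (ℤ._* Y) (trans (sym (ℤ.pos-+ z x))
                                                                (cong +_ (trans (ℕ.+-comm z x) x+z≡))) ⟩
      Y ℤ.* Y                             ≡⟨ ℤ.*-identityˡ (Y ℤ.* Y) ⟨
      + 1 ℤ.* (Y ℤ.* Y)                   ∎))))
    where Y = + suc y

n<2^n : ∀ n → n <ℕ 2 ^ n
n<2^n zero    = ℕ.s≤s ℕ.z≤n
n<2^n (suc n) = ℕ.≤-trans (ℕ.+-mono-≤ (ℕ.m^n>0 2 n) (n<2^n n)) (ℕ.+-monoʳ-≤ (2 ^ n) (ℕ.m≤m+n _ _))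

-- A positive `ε` is at least the reciprocal of its denominator, which exceeds `2 ^ (- E)` because
-- `E < 2 ^ E`.
fraction< : ∀ {x y E} .{{_ : NonZero y}} ε → 0ℚ < ε → x *ℕ 2 ^ E ≤ℕ y → ↧ₙ ε ≤ℕ E → + x / y < ε
fraction< {x} {y} {E} ε@(mkℚ +[1+ p ] d-1 _) _ x2^E≤y d≤E = go x2^E≤y
  where
  d = suc d-1
  go : ∀ {y} .{{_ : NonZero y}} → x *ℕ 2 ^ E ≤ℕ y → + x / y < ε
  go {zero} {{()}}
  go {suc y} x2^E≤y = ℚ.toℚᵘ-cancel-< (ℚᵘ.<-respˡ-≃ (ℚᵘ.≃-sym (toℚᵘ-/ x y))
    (ℚᵘ.*<* (subst (ℤ._< + suc p ℤ.* + suc y) (ℤ.pos-* x d)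
      (subst (+ (x *ℕ d) ℤ.<_) (ℤ.pos-* (suc p) (suc y)) (ℤ.+<+ (ℕ.<-≤-trans xd<y (ℕ.m≤m+n (suc y) _)))))))
    where
    below : ∀ x → x *ℕ 2 ^ E ≤ℕ suc y → x *ℕ d <ℕ suc y
    below zero    _ = ℕ.s≤s ℕ.z≤n
    below x@(suc _) ≤y = ℕ.<-≤-trans (ℕ.*-monoʳ-< x (ℕ.≤-<-trans d≤E (n<2^n E))) ≤y
    xd<y : x *ℕ d <ℕ suc y
    xd<y = below x x2^E≤y
fraction< (mkℚ +0 _ _) 0<ε _ _ with () ← positive 0<ε
fraction< (mkℚ -[1+ _ ] _ _) 0<ε _ _ with () ← positive 0<ε

fraction-near-1 : ∀ {x z y E} .{{_ : NonZero y}} ε → 0ℚ < ε → x +ℕ z ≡ y → x *ℕ 2 ^ E ≤ℕ y → ↧ₙ ε ≤ℕ E →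
                  ∣ + z / y - 1ℚ ∣ < ε
fraction-near-1 {x} {z} {y} ε 0<ε x+z≡y x2^E≤y d≤E = subst (_< ε) (sym (begin
  ∣ + z / y - 1ℚ ∣    ≡⟨ cong ∣_∣ (complementary-fractions {x} {z} x+z≡y) ⟩
  ∣ - (+ x / y) ∣     ≡⟨ ℚ.∣-p∣≡∣p∣ (+ x / y) ⟩
  ∣ + x / y ∣         ≡⟨ ℚ.0≤p⇒∣p∣≡p (ℚ.nonNegative⁻¹ (+ x / y) {{ℚ.normalize-nonNeg x y}}) ⟩
  + x / y             ∎)) (fraction< {x} {y} ε 0<ε x2^E≤y d≤E)
  where open ≡-Reasoning

-- Largest arities and the conclusion

max-∈ : ∀ {x} {xs : List ℕ} → x ∈ xs → 0 <ℕ x → max 0 xs ∈ xs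
max-∈ {x} {xs} x∈ 0<x with argmax-sel id 0 xs
... | inj₂ max∈  = max∈
... | inj₁ max≡0 = contradiction (subst (x ≤ℕ_) max≡0 (ListAll.lookup (xs≤max 0 xs) x∈)) (ℕ.<⇒≱ 0<x)

module _ (L : Vocabulary) where

  arity-∈ : ∀ k → arity L k ∈ Vec.toList (arities L)
  arity-∈ k = ∈-toList⁺ (∈ᵥ-lookup k (arities L))

  ∈-arity : ∀ {r} → r ∈ Vec.toList (arities L) → ∃[ k ] arity L k ≡ r
  ∈-arity r∈ = VecAny.index (∈-toList⁻ r∈) , sym (VecAny.lookup-index (∈-toList⁻ r∈))

  0<arity : ∀ k → 0 <ℕ arity L k
  0<arity k = ℕ.≤-trans (ℕ.n≤1+n 1) (arity≥2 L k)

  maxArity-attained : ∃[ k ] arity L k ≡ maxArity L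
  maxArity-attained = ∈-arity (max-∈ (arity-∈ (Fin.fromℕ< (ρ>0 L))) (0<arity _))

  arity≤maxArity : ∀ k → arity L k ≤ℕ maxArity L
  arity≤maxArity k = ListAll.lookup (xs≤max 0 (Vec.toList (arities L))) (arity-∈ k)

  module _ {l : ℕ} where

    private
      arity-∈≤ : ∀ {k} → arity L k ≤ℕ l → arity L k ∈ filter (ℕ._≤? l) (Vec.toList (arities L))
      arity-∈≤ {k} = ∈-filter⁺ (ℕ._≤? l) (arity-∈ k)

    maxArity≤-attained : ∀ {k} → arity L k ≤ℕ l → ∃[ k ] arity L k ≡ maxArity≤ L l × maxArity≤ L l ≤ℕ l
    maxArity≤-attained {k} k≤l =
      let max∈ , max≤l = ∈-filter⁻ (ℕ._≤? l) {xs = Vec.toList (arities L)} (max-∈ (arity-∈≤ k≤l) (0<arity k))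
          k′ , k′≡ = ∈-arity max∈
      in k′ , k′≡ , max≤l

    arity≤maxArity≤ : ∀ k → arity L k ≤ℕ l → arity L k ≤ℕ maxArity≤ L l
    arity≤maxArity≤ k k≤l =
      ListAll.lookup (xs≤max 0 (filter (ℕ._≤? l) (Vec.toList (arities L)))) (arity-∈≤ k≤l)

≤-suc-cases : ∀ {r m} {A : Set} → r ≤ℕ suc m → r ≤ℕ m ⊎ r ≡ suc m ⊎ A
≤-suc-cases r≤ with ℕ.m≤n⇒m<n∨m≡n r≤
... | inj₁ r< = inj₁ (ℕ.s≤s⁻¹ r<)
... | inj₂ r≡ = inj₂ (inj₁ r≡)

non-rich-class : ∀ {l n} d-1 (γ : Colouring l n) → ¬ Rich (unitFraction d-1 * (+ n / 1)) γ →
                 ∃[ i ] length (colourClass γ i) *ℕ suc d-1 <ℕ n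
non-rich-class {n = n} d-1 γ ¬rich =
  let i , small = ¬∀⟶∃¬ _ _ (λ i → α ℚ.≤? (+ fibreSize γ i / 1)) ¬rich
  in i , ℕ.≰⇒> λ n≤ → small (unitFraction-*≤ {n} {fibreSize γ i} d-1
       (subst (λ k → n ≤ℕ k *ℕ suc d-1) (sym (fibreSize≡length γ i)) n≤))
  where α = unitFraction d-1 * (+ n / 1)

module _ {l} (C : ColourRule l) (L : Vocabulary) (I : Subset (ρ L)) where

  open ColourRule C

  ColourableStructure : ∀ n → Pred (Structure L n) 0ℓ
  ColourableStructure n M = ∃ (λ γ → Obeys γ M) × IrreflexiveSymmetricOn L I M

  HasNonRich : ℚ → ∀ n → Pred (Structure L n) 0ℓ
  HasNonRich μ n M = ∃[ γ ] Obeys γ M × ¬ Rich (μ * (+ n / 1)) γ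

  OnlyRich : ℚ → ∀ n → Pred (Structure L n) 0ℓ
  OnlyRich μ n M = ∀ γ → Obeys γ M → Rich (μ * (+ n / 1)) γ

  module Conclusion {m q N d : ℕ} .{{_ : NonZero q}} .{{_ : NonZero d}}
           (small : ∀ k → arity L k ≤ℕ suc m ⊎ arity L k ≡ suc (suc m) ⊎
                          (∀ (c : Fin (arity L k) → Fin l) → ¬ good c))
           (k : Fin (ρ L)) (k≡ : arity L k ≡ suc (suc m))
           (improvable : ∀ {n} → N ≤ℕ n → ∀ (γ : Colouring l n) i → length (colourClass γ i) *ℕ d <ℕ n →
                         Improvable C (ρ L) (suc (suc m)) q γ)
           (K? : ∀ n → Decidable (ColourableStructure n))
           (K≢0 : ∀ n → NonZero (card (K? n)))
           where

    μ κ : ℚ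
    μ = unitFraction (pred d)
    κ = unitFraction (pred q)

    -- `N` serves `improvable`, the product serves the terms of lower order, and the successor makes
    -- `n` positive.
    threshold : ℕ
    threshold = suc (N +ℕ q *ℕ (ρ L +ℕ l +ℕ 1))

    module _ (bad? : ∀ n → Decidable (HasNonRich μ n)) (rich-only? : ∀ n → Decidable (OnlyRich μ n)) where

      -- The successor turns rounding down into an upper bound: `q * exponent n` reaches
      -- `n ^ suc (suc m)`.
      exponent : ℕ → ℕ
      exponent n = suc ((n ^ suc (suc m)) ℕ./ q)

      q*exponent : ∀ n → n ^ suc (suc m) ≤ℕ q *ℕ exponent n
      q*exponent n = n≤d*[1+n/d] (n ^ suc (suc m)) q

      bad-rare : ∀ n → threshold ≤ℕ n → card (K? n ∩? bad? n) *ℕ 2 ^ exponent n ≤ℕ card (K? n)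
      bad-rare n n≥ = improvable⇒rare C L I {m = m} {q = q} {{_}}
        {{ℕ.>-nonZero (ℕ.≤-trans (ℕ.s≤s ℕ.z≤n) n≥)}} small k k≡
        (ℕ.≤-trans (ℕ.m≤n+m _ N) (ℕ.<⇒≤ n≥))
        (¬? ∘ rich? (μ * (+ n / 1))) (λ e ¬rich → ¬rich ∘ rich-ext (μ * (+ n / 1)) (sym ∘ e))
        (λ γ ¬rich → let i , i-small = non-rich-class (pred d) γ ¬rich in
          improvable (ℕ.≤-trans (ℕ.m≤m+n N _) (ℕ.<⇒≤ n≥)) γ i
            (subst (λ d → length (colourClass γ i) *ℕ d <ℕ n) (ℕ.suc-pred d) i-small))
        (K? n) (K? n ∩? bad? n)
        (λ {_} {γ} (o , i) → (γ , o) , i)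
        (λ ((_ , i) , γ , o , ¬rich) → γ , ¬rich , o , i)

      bad-proportion : Eventually λ n →
        proportion (K? n) {{K≢0 n}} (bad? n) ≤2^-[ κ · n ^ suc (suc m) ]
      bad-proportion = threshold , λ n n≥ →
        fraction≤2^- {card (K? n ∩? bad? n)} {E = exponent n} {{K≢0 n}} (pred q) (bad-rare n n≥)
        (subst (λ q′ → n ^ suc (suc m) ≤ℕ q′ *ℕ exponent n) (sym (ℕ.suc-pred q)) (q*exponent n))

      rich-proportion : (λ n → proportion (K? n) {{K≢0 n}} (rich-only? n)) ⟶ 1ℚ
      -- The extra summand pushes `exponent n` up to the denominator of `ε`.
      rich-proportion ε 0<ε = threshold +ℕ q *ℕ ↧ₙ ε , λ n n≥ →
        fraction-near-1 {card (K? n ∩? bad? n)} {E = exponent n} {{K≢0 n}} ε 0<ε (partition n)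
          (bad-rare n (ℕ.≤-trans (ℕ.m≤m+n _ _) n≥))
          (ℕ.*-cancelˡ-≤ q (begin
            q *ℕ ↧ₙ ε          ≤⟨ ℕ.≤-trans (ℕ.m≤n+m _ threshold) n≥ ⟩
            n                  ≤⟨ m≤m^[1+n] n (suc m) ⟩
            n ^ suc (suc m)    ≤⟨ q*exponent n ⟩
            q *ℕ exponent n    ∎))
        where
        open ℕ.≤-Reasoning
        partition : ∀ n → card (K? n ∩? bad? n) +ℕ card (K? n ∩? rich-only? n) ≡ card (K? n)
        partition n = #-partition (K? n ∩? bad? n) (K? n ∩? rich-only? n) (K? n)
          (λ κM ¬bad → κM , λ γ o → decidable-stable (rich? _ γ) λ ¬rich → ¬bad (κM , γ , o , ¬rich))
          (λ (κM , γ , o , ¬rich) → κM , λ (_ , only) → ¬rich (only γ o))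
          proj₁ (structures L n)

theorem10p5 : (l : ℕ) .{{_ : NonTrivial l}} (L : Vocabulary) →
    ((I : Subset (ρ L)) →
    ∃[ μ ] ∃[ κ ] 0ℚ < μ × 0ℚ < κ ×
    (Eventually λ n →
    proportion-𝐂 l L I n (hasNonRichColouring? l L (μ * (+ n / 1)))
    ≤2^-[ κ · n ^ maxArity L ]) ×
    ((λ n → proportion-𝐂 l L I n (onlyRichColourings? l L (μ * (+ n / 1))))
    ⟶ 1ℚ))
    × ((∃[ k ] arity L k ≤ℕ l) →
    (I : Subset (ρ L)) →
    ∃[ μ ] ∃[ κ ] 0ℚ < μ × 0ℚ < κ ×
    (Eventually λ n →
    proportion-𝐒 l L I n (hasNonRichStrongColouring? l L (μ * (+ n / 1)))
    ≤2^-[ κ · n ^ maxArity≤ L l ]) ×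
    ((λ n → proportion-𝐒 l L I n (onlyRichStrongColourings? l L (μ * (+ n / 1))))
    ⟶ 1ℚ))
theorem10p5 l L =
  colourings (maxArity-attained L) (arity≤maxArity L) ,
  λ (_ , k≤l) → strongColourings (maxArity≤-attained L k≤l) (arity≤maxArity≤ L)
  where
  instance
    l≢0 : NonZero l
    l≢0 = nonTrivial⇒nonZero l
    ρ≢0 : NonZero (ρ L)
    ρ≢0 = ℕ.>-nonZero (ρ>0 L)

  -- Stated for a variable `r`, which can be matched: the blocks require it to be `suc (suc m)`.
  colourings : ∀ {r} → ∃[ k ] arity L k ≡ r → (∀ k → arity L k ≤ℕ r) →
    (I : Subset (ρ L)) → ∃[ μ ] ∃[ κ ] 0ℚ < μ × 0ℚ < κ ×
    (Eventually λ n →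
      proportion-𝐂 l L I n (hasNonRichColouring? l L (μ * (+ n / 1))) ≤2^-[ κ · n ^ r ]) ×
    ((λ n → proportion-𝐂 l L I n (onlyRichColourings? l L (μ * (+ n / 1)))) ⟶ 1ℚ)
  colourings {zero}        (k , k≡) _    I =
    contradiction (subst (2 ≤ℕ_) k≡ (arity≥2 L k)) λ ()
  colourings {suc zero}    (k , k≡) _    I =
    contradiction (subst (2 ≤ℕ_) k≡ (arity≥2 L k)) (ℕ.<-irrefl refl)
  colourings {suc (suc m)} (k , k≡) ≤max I =
    μ , κ , 0<unitFraction _ , 0<unitFraction _ ,
    bad-proportion bad? rich-only? , rich-proportion bad? rich-only?
    where
    open NonMonochromatic l m (ρ L)
    instance
      q≢0 : NonZero (4 *ℕ c₀ ^ M)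
      q≢0 = ℕ.m*n≢0 4 (c₀ ^ M) {{_}} {{ℕ.m^n≢0 c₀ M {{ℕ.m*n≢0 2 (l *ℕ M) {{_}} {{ℕ.m*n≢0 l M}}}}}}
      scale≢0 : NonZero (scale c₀)
      scale≢0 = ℕ.m*n≢0 (4 *ℕ c₀ ^ M *ℕ ρ L) M {{ℕ.m*n≢0 (4 *ℕ c₀ ^ M) (ρ L)}}
    -- Thus `μ` is `1 / scale c₀` and `κ` is `1 / (4 * c₀ ^ M)`.
    open Conclusion (nonMonochromatic l) L I {m} {4 *ℕ c₀ ^ M} {l *ℕ M} {scale c₀}
      (≤-suc-cases ∘ ≤max) k k≡ improvable (𝐂? l L I) (card-𝐂≢0 l L I)
    bad? = λ n → hasNonRichColouring? l L {n} (μ * (+ n / 1))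
    rich-only? = λ n → onlyRichColourings? l L {n} (μ * (+ n / 1))

  strongColourings : ∀ {r} → ∃[ k ] arity L k ≡ r × r ≤ℕ l → (∀ k → arity L k ≤ℕ l → arity L k ≤ℕ r) →
    (I : Subset (ρ L)) → ∃[ μ ] ∃[ κ ] 0ℚ < μ × 0ℚ < κ ×
    (Eventually λ n →
      proportion-𝐒 l L I n (hasNonRichStrongColouring? l L (μ * (+ n / 1))) ≤2^-[ κ · n ^ r ]) ×
    ((λ n → proportion-𝐒 l L I n (onlyRichStrongColourings? l L (μ * (+ n / 1)))) ⟶ 1ℚ)
  strongColourings {zero}        (k , k≡ , _)   _    I =
    contradiction (subst (2 ≤ℕ_) k≡ (arity≥2 L k)) λ ()
  strongColourings {suc zero}    (k , k≡ , _)   _    I =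
    contradiction (subst (2 ≤ℕ_) k≡ (arity≥2 L k)) (ℕ.<-irrefl refl)
  strongColourings {suc (suc m)} (k , k≡ , r≤l) ≤max I =
    μ , κ , 0<unitFraction _ , 0<unitFraction _ ,
    bad-proportion bad? rich-only? , rich-proportion bad? rich-only?
    where
    open Rainbow l m (ρ L) r≤l
    -- A rainbow tuple is an injection into the `l` colours, so none exists for an arity above `l`.
    small : ∀ k → arity L k ≤ℕ suc m ⊎ arity L k ≡ suc (suc m) ⊎
                  (∀ (c : Fin (arity L k) → Fin l) → ¬ Distinct c)
    small k with arity L k ℕ.≤? l
    ... | yes k≤l = ≤-suc-cases (≤max k k≤l)
    ... | no  k≰l = inj₂ (inj₂ λ c distinct → k≰l (injective⇒≤ {f = c} λ {i} {j} eq →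
      decidable-stable (i ≟ j) λ i≢j → distinct i j i≢j eq))
    c₀>0 : 0 <ℕ c₀
    c₀>0 = ℕ.≤-trans (ℕ.≤-trans (ℕ.>-nonZero⁻¹ l) l≤d) (ℕ.≤-trans (ℕ.m≤n*m d 2) (ℕ.m≤m*n (2 *ℕ d) 4))
    instance
      q≢0 : NonZero (4 *ℕ c₀ ^ M)
      q≢0 = ℕ.m*n≢0 4 (c₀ ^ M) {{_}} {{ℕ.m^n≢0 c₀ M {{ℕ.>-nonZero c₀>0}}}}
      scale≢0 : NonZero (scale c₀)
      scale≢0 = ℕ.m*n≢0 (4 *ℕ c₀ ^ M *ℕ ρ L) M {{ℕ.m*n≢0 (4 *ℕ c₀ ^ M) (ρ L)}}
    open Conclusion (rainbow l) L I {m} {4 *ℕ c₀ ^ M} {2 *ℕ d} {scale c₀}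
      small k k≡ improvable (𝐒? l L I) (card-𝐒≢0 l L I)
    bad? = λ n → hasNonRichStrongColouring? l L {n} (μ * (+ n / 1))
    rich-only? = λ n → onlyRichStrongColourings? l L {n} (μ * (+ n / 1))
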